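{- Let $G$ be a $3$-connected cubic plane bipartite graph whose faces are properly $3$-colored with color set $\{1,2,3\}$, such that the outer face of $G$ is a $3$-face. Then the following statements are equivalent: (i) $G$ has a hamiltonian cycle $C$ such that all $2$-faces lie inside $C$, all $3$-faces lie outside $C$ (and $1$-faces lie on either side); (ii) the reduced graph $H$ obtained from $G$ by contracting each $1$-face to a single vertex has an $A$-trail; (iii) the reduced graph $H'$ obtained from $G$ by contracting each $2$-face to a single vertex has a spanning tree of $1$-faces; (iv) the reduced graph $H''$ obtained from $G$ by contracting each $3$-face to a single vertex has a spanning tree of $1$-faces.
   Context: Faces are identified with their boundaries; a proper face-coloring assigns different colors to faces sharing an edge, and a face of color $i$ is called an $i$-face. Contracting the faces of one color class (which form a facial $2$-factor) yields a plane multigraph whose faces correspond to the faces of $G$ of the other two colors; a "$1$-face" of $H'$ or $H''$ means a face arising from a $1$-face of $G$. For a plane graph, at each vertex $v$ the counterclockwise cyclic order of the edges incident to $v$ is $\langle e_1,\dots,e_{\deg(v)}\rangle$. An $A$-trail in a plane eulerian graph is a closed eulerian trail such that whenever $e_i,e_j$ are consecutive edges of the trail at a vertex $v$, we have $j=i\pm 1 \pmod{\deg(v)}$. For a $2$-connected plane graph $K$, the radial graph $\mathcal{R}(K)$ is the bipartite graph on $V(K)\cup\mathcal{F}(K)$ ($\mathcal{F}(K)$ the set of faces) with $x$ adjacent to $F$ iff $x$ lies on the boundary of $F$; for $U\subseteq V(K)$ and a set $\mathcal{T}$ of bounded faces, $\mathcal{R}(U,\mathcal{T})$ is the subgraph induced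 by $U\cup\mathcal{T}$. A spanning tree of faces is a set $\mathcal{T}$ of bounded faces with $\mathcal{R}(V(K),\mathcal{T})$ a tree; a spanning tree of $1$-faces is one all of whose faces are $1$-faces. -}

module Defs where

-- Plane graphs are encoded as combinatorial maps (rotation systems):
-- darts Fin n, a fixed-point-free involution α (the two darts of an edge),
-- a permutation σ (counterclockwise rotation of darts at a vertex),
-- faces = orbits of φ = σ ∘ α.  Vertices/edges/faces are orbits of σ/α/φ;
-- a vertex/face is represented by any dart of it.  The plane embedding is
-- the (connected, genus 0) map together with a chosen outer face (a dart o).

open import Data.Nat using (ℕ; zero; suc; _+_; _≤_; _≤ᵇ_)
open import Data.Fin using (Fin; toℕ)
open import Data.Fin.Permutation using (Permutation′; _⟨$⟩ʳ_)
open import Data.List using (List; []; _∷_; _++_; [_]; map; upTo; allFin; length; filter)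
open import Data.List.Relation.Unary.All using (All)
open import Data.List.Relation.Unary.AllPairs using (AllPairs)
open import Data.Nat.ListAction using (sum)
open import Data.Bool.ListAction using (and)
open import Data.Bool using (Bool; true; false; if_then_else_)
open import Data.Product using (Σ; Σ-syntax; ∃; ∃-syntax; _×_; _,_)
open import Data.Sum using (_⊎_)
open import Data.Unit using (⊤)
open import Relation.Nullary using (¬_)
open import Relation.Binary.PropositionalEquality using (_≡_; _≢_)
open import Relation.Binary.Construct.Closure.ReflexiveTransitive using (Star)
import Data.Fin.Properties as FinP

data Color : Set where
  c1 c2 c3 : Color

iter : {n : ℕ} → (Fin n → Fin n) → ℕ → Fin n → Fin n
iter f zero d = d
iter f (suc k) d = f (iter f k d)

SameOrbit : {n : ℕ} → Permutation′ n → Fin n → Fin n → Set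
SameOrbit π d e = ∃[ k ] iter (π ⟨$⟩ʳ_) k d ≡ e

isRep : {n : ℕ} → (Fin n → Fin n) → Fin n → Bool
isRep {n} f d = and (map (λ k → toℕ d ≤ᵇ toℕ (iter f k d)) (upTo n))

orbitCountF : {n : ℕ} → (Fin n → Fin n) → ℕ
orbitCountF {n} f = sum (map (λ d → if isRep f d then 1 else 0) (allFin n))

orbitCount : {n : ℕ} → Permutation′ n → ℕ
orbitCount π = orbitCountF (π ⟨$⟩ʳ_)

module Map {n : ℕ} (σ α : Permutation′ n) where

  φ : Fin n → Fin n
  φ d = σ ⟨$⟩ʳ (α ⟨$⟩ʳ d)

  SameV : Fin n → Fin n → Set
  SameV = SameOrbit σ

  SameF : Fin n → Fin n → Set
  SameF d e = ∃[ k ] iter φ k d ≡ e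

  data MStep : Fin n → Fin n → Set where
    viaσ : ∀ d → MStep d (σ ⟨$⟩ʳ d)
    viaα : ∀ d → MStep d (α ⟨$⟩ʳ d)

  -- connected plane (genus 0) map: V - E + F = 2
  IsPlaneMap : Set
  IsPlaneMap =
    (∀ d → α ⟨$⟩ʳ (α ⟨$⟩ʳ d) ≡ d) ×
    (∀ d → α ⟨$⟩ʳ d ≢ d) ×
    (∀ d e → Star MStep d e) ×
    (orbitCount σ + orbitCountF φ ≡ orbitCount α + 2)

  Simple : Set
  Simple = (∀ d → ¬ SameV d (α ⟨$⟩ʳ d)) ×
           (∀ d e → SameV d e → SameV (α ⟨$⟩ʳ d) (α ⟨$⟩ʳ e) → d ≡ e)

  Cubic : Set
  Cubic = ∀ d → (σ ⟨$⟩ʳ d ≢ d) × (σ ⟨$⟩ʳ (σ ⟨$⟩ʳ d) ≢ d) ×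
                (σ ⟨$⟩ʳ (σ ⟨$⟩ʳ (σ ⟨$⟩ʳ d)) ≡ d)

  Bipartite : Set
  Bipartite = Σ[ c ∈ (Fin n → Bool) ] ((∀ d → c (σ ⟨$⟩ʳ d) ≡ c d) × (∀ d → c (α ⟨$⟩ʳ d) ≢ c d))

  -- steps of the graph with the darts satisfying R deleted (R = darts at removed vertices)
  data AvoidStep (R : Fin n → Set) : Fin n → Fin n → Set where
    aσ : ∀ d → ¬ R (σ ⟨$⟩ʳ d) → AvoidStep R d (σ ⟨$⟩ʳ d)
    aα : ∀ d → ¬ R (α ⟨$⟩ʳ d) → AvoidStep R d (α ⟨$⟩ʳ d)

  ThreeConnected : Set
  ThreeConnected =
    (4 ≤ orbitCount σ) ×
    (∀ x y d e → ¬ (SameV x d ⊎ SameV y d) → ¬ (SameV x e ⊎ SameV y e) →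
       Star (AvoidStep (λ z → SameV x z ⊎ SameV y z)) d e)

  ProperFaceColoring : (Fin n → Color) → Set
  ProperFaceColoring col = (∀ d → col (φ d) ≡ col d) × (∀ d → col (α ⟨$⟩ʳ d) ≢ col d)

  -- (i) hamiltonian cycle C (edge set S, closed under α)
  data CStep (S : Fin n → Bool) : Fin n → Fin n → Set where
    cσ : ∀ d → CStep S d (σ ⟨$⟩ʳ d)
    cα : ∀ d → S d ≡ true → CStep S d (α ⟨$⟩ʳ d)

  count3 : Bool → Bool → Bool → ℕ
  count3 a b c = (if a then 1 else 0) + (if b then 1 else 0) + (if c then 1 else 0)

  -- spanning connected 2-regular subgraph (cubic G: 3 darts per vertex)
  IsHamCycle : (Fin n → Bool) → Set
  IsHamCycle S =
    (∀ d → S (α ⟨$⟩ʳ d) ≡ S d) ×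
    (∀ d → count3 (S d) (S (σ ⟨$⟩ʳ d)) (S (σ ⟨$⟩ʳ (σ ⟨$⟩ʳ d))) ≡ 2) ×
    (∀ d e → Star (CStep S) d e)

  -- moving between faces without crossing C
  data DStep (S : Fin n → Bool) : Fin n → Fin n → Set where
    dφ : ∀ d → DStep S d (φ d)
    dα : ∀ d → S d ≡ false → DStep S d (α ⟨$⟩ʳ d)

  -- the face of dart d lies outside C: same side of C as the outer face o
  Outside : (Fin n → Bool) → Fin n → Fin n → Set
  Outside S o d = Star (DStep S) o d

  StatementI : (Fin n → Color) → Fin n → Set
  StatementI col o = ∃[ S ] (IsHamCycle S ×
    (∀ d → (col d ≡ c2 → ¬ Outside S o d) × (col d ≡ c3 → Outside S o d)))

  -- (ii) H = G with every 1-face contracted to a vertex.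
  -- Darts of H: darts of G whose edge lies on no 1-face; α as in G.
  HDart : (Fin n → Color) → Fin n → Set
  HDart col d = (col d ≢ c1) × (col (α ⟨$⟩ʳ d) ≢ c1)

  -- rotation of H at the vertex (contracted 1-face F): d' follows d
  -- when the vertex of d' is the next vertex after that of d along F
  HRot : (Fin n → Color) → Fin n → Fin n → Set
  HRot col d d' = HDart col d × HDart col d' ×
    ∃[ a ] (SameV d a × col a ≡ c1 × SameV (φ a) d')

  Chain : {A : Set} → (A → A → Set) → A → List A → Set
  Chain R x [] = ⊤
  Chain R x (y ∷ ys) = R x y × Chain R y ys

  Cyclic : {A : Set} → (A → A → Set) → List A → Set
  Cyclic R [] = ⊤
  Cyclic R (x ∷ xs) = Chain R x (xs ++ [ x ])

  occ : List (Fin n) → Fin n → ℕ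
  occ L d = length (filter (FinP._≟ d) L)

  -- A-trail: closed trail given by its list of traversed darts, using every
  -- edge of H exactly once, each transition (incoming dart α e, outgoing e')
  -- being between rotation-consecutive darts at the common vertex.
  HasATrail : (Fin n → Color) → Set
  HasATrail col = ∃[ L ] (All (HDart col) L ×
    (∀ d → HDart col d → occ L d + occ L (α ⟨$⟩ʳ d) ≡ 1) ×
    Cyclic (λ e e' → HRot col (α ⟨$⟩ʳ e) e' ⊎ HRot col e' (α ⟨$⟩ʳ e)) L)

  -- (iii),(iv): contracting the k-faces (k = c2 or c3); the vertices of the
  -- reduced graph are the k-faces, its faces are the faces of the other two
  -- colours.  A k-face x lies on the boundary of a 1-face F of the reduced
  -- graph iff x and F share a vertex of G.
  Inc : Fin n → Fin n → Set
  Inc x F = ∃[ a ] ∃[ b ] (SameF x a × SameF F b × SameV a b)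

  -- radial graph R(V, T), nodes represented by darts of the faces
  data REdge (col : Fin n → Color) (k : Color) (T : Fin n → Bool) : Fin n → Fin n → Set where
    vf : ∀ {u w} → col u ≡ k → T w ≡ true → Inc u w → REdge col k T u w
    fv : ∀ {u w} → T u ≡ true → col w ≡ k → Inc w u → REdge col k T u w
    same : ∀ {u w} → SameF u w → REdge col k T u w

  RNode : (Fin n → Color) → Color → (Fin n → Bool) → Fin n → Set
  RNode col k T d = col d ≡ k ⊎ T d ≡ true

  -- a cycle x0 F0 x1 F1 ... x(m-1) F(m-1) x0 of the radial graph, m ≥ 2,
  -- with pairwise distinct vertices x i and pairwise distinct faces F i
  RCycle : (Fin n → Color) → Color → (Fin n → Bool) → Set
  RCycle col k T = Σ[ P ∈ List (Fin n × Fin n) ] (2 ≤ length P ×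
    All (λ { (x , F) → col x ≡ k × T F ≡ true × Inc x F }) P ×
    Cyclic (λ { (x , F) (x' , F') → Inc x' F }) P ×
    AllPairs (λ { (x , _) (x' , _) → ¬ SameF x x' }) P ×
    AllPairs (λ { (_ , F) (_ , F') → ¬ SameF F F' }) P)

  IsRadialTree : (Fin n → Color) → Color → (Fin n → Bool) → Set
  IsRadialTree col k T =
    (∀ u w → RNode col k T u → RNode col k T w → Star (REdge col k T) u w) ×
    ¬ RCycle col k T

  HasSpanningTreeOf1Faces : (Fin n → Color) → Color → Set
  HasSpanningTreeOf1Faces col k = ∃[ T ] (
    (∀ d → T (φ d) ≡ T d) ×
    (∀ d → T d ≡ true → col d ≡ c1) ×
    IsRadialTree col k T)

{-# OPTIONS --safe #-}
-- A hamiltonian cycle as in (i) is the same as one through all edges that lie on no 1-face; it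
-- is the boundary of the region formed by the k-faces and a set T of 1-faces, for k = 2 and
-- also (with the complementary T) for k = 3, and it is an A-trail of H read off in G.
--
-- If the radial graph of (k-faces, T) is a tree, every edge inside the region is a bridge of
-- the dual, so its ends are joined along the boundary: otherwise the cut of the primal component
-- and the boundary of the dual component would meet in that edge only, although a cut and a
-- boundary are always orthogonal.  Hence the boundary is connected.  Conversely, a connected
-- boundary contains a spanning tree; the remaining edges then connect the dual, and by Euler's
-- formula there are only F − 1 of them, so the dual edges inside the region form no cycle.
module Submission where

open import Defs
open import Data.Nat using (ℕ; zero; suc; _+_; _*_; _≤_; _<_; z≤n; s≤s)
open import Data.Nat.DivMod using (_/_; _%_; m≡m%n+[m/n]*n; m%n<n)
open import Data.Nat.ListAction using (sum)
import Data.Nat.Properties as ℕ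
open import Data.Bool using (Bool; true; false; if_then_else_; _∧_; _∨_; not; _xor_)
open import Data.Bool.ListAction using (and)
import Data.Bool.Properties as Bool
open import Data.Empty using (⊥-elim)
open import Data.Fin using (Fin; toℕ)
import Data.Fin as Fin
import Data.Fin.Properties as Fin
open import Data.Fin.Permutation using (Permutation′; permutation; _⟨$⟩ʳ_; _⟨$⟩ˡ_; inverseˡ; _∘ₚ_)
open import Data.List using (List; []; _∷_; _++_; [_]; map; upTo; applyUpTo; allFin; length; filter)
open import Data.List.Properties using (filter-all; filter-none; filter-accept; filter-reject; filter-notAll; length-map)
open import Data.List.Membership.Propositional using (_∈_; lose; find)
open import Data.List.Membership.Propositional.Properties using (∈-upTo⁺; ∈-applyUpTo⁺; ∈-allFin; ∈-map⁺; ∈-map⁻; ∈-filter⁺; ∈-++⁺ˡ; ∈-++⁺ʳ; ∈-++⁻)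
import Data.List.Membership.DecPropositional as DecMembership
open import Data.List.Relation.Unary.Any using (here; there; any?)
import Data.List.Relation.Unary.Any as Any
open import Data.List.Relation.Unary.All using (All; []; _∷_)
import Data.List.Relation.Unary.All as All
import Data.List.Relation.Unary.All.Properties as All
open import Data.List.Relation.Unary.AllPairs using (AllPairs; []; _∷_)
import Data.List.Relation.Unary.AllPairs as AllPairs
import Data.List.Relation.Unary.AllPairs.Properties as AllPairs
open import Data.List.Relation.Unary.Unique.Propositional using (Unique)
import Data.List.Relation.Unary.Unique.Propositional.Properties as Unique
open import Data.Product using (∃-syntax; _×_; _,_; uncurry; proj₁; proj₂)
import Data.Product.Properties as Product
open import Data.Sum using (_⊎_; inj₁; inj₂; [_,_]′; swap)
import Data.Sum as ⊎
open import Function using (id; _∘_)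
open import Function.Bundles using (_⇔_; mk⇔; module Equivalence)
open import Relation.Nullary using (¬_; Dec; yes; no; contradiction; ¬?; does; map′; _→-dec_; _⊎-dec_; _×-dec_; from-yes)
open import Relation.Nullary.Decidable using (dec-true; dec-false; does-⇔)
open import Relation.Binary.PropositionalEquality using (_≡_; _≢_; refl; sym; trans; cong; cong₂; subst; subst₂; module ≡-Reasoning)
open import Relation.Binary.Structures using (IsEquivalence)
open import Relation.Binary.Construct.Closure.ReflexiveTransitive using (Star; ε; _◅_; _◅◅_)
import Relation.Binary.Construct.Closure.ReflexiveTransitive as Star
import Algebra.Properties.CommutativeMonoid.Sum ℕ.+-0-commutativeMonoid as Sum

-- Orbits of a permutation

-- No Jordan curve theorem is available: inside and outside are reachability of faces across edges
-- off the cycle. Genus 0 enters only as Euler's formula, in `bridge`; its counterpart `dichotomy`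
-- holds on maps of any genus. The obstacle is that the trees live in the radial graph, whereas
-- duality speaks of dual edges. At a cubic vertex any two faces share an edge, so incidence of a
-- k-face and a 1-face is adjacency in the dual. Two faces with two common edges would however form
-- a dual cycle of length two, which `RCycle` does not see because it asks for two distinct vertices
-- and two distinct faces. 3-connectivity excludes such pairs (`share-one-edge`). The intermediate
-- notion `Core` does not distinguish colours 2 and 3, so one module with a parameter k serves
-- (iii), (iv) and, with k = 3, the return to (i), where the radial graph supplies the walks between
-- 3-faces. Cuts are given by characteristic functions, so connectivity has to be decided;
-- union-find decides it and also yields the counts that are compared with Euler's formula.

module _ {n : ℕ} where

  iter-+ : (f : Fin n → Fin n) (j k : ℕ) (d : Fin n) → iter f (j + k) d ≡ iter f j (iter f k d)
  iter-+ f zero    k d = refl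
  iter-+ f (suc j) k d = cong f (iter-+ f j k d)

  iter-*-fixed : (f : Fin n → Fin n) (p : ℕ) {d : Fin n} → iter f p d ≡ d → ∀ m → iter f (m * p) d ≡ d
  iter-*-fixed f p eq zero    = refl
  iter-*-fixed f p eq (suc m) =
    trans (iter-+ f p (m * p) _) (trans (cong (iter f p) (iter-*-fixed f p eq m)) eq)

  iter-% : (f : Fin n → Fin n) (q : ℕ) {d : Fin n} → iter f (suc q) d ≡ d → ∀ k → iter f (k % suc q) d ≡ iter f k d
  iter-% f q {d} eq k = sym (begin
    iter f k d                                           ≡⟨ cong (λ m → iter f m d) (m≡m%n+[m/n]*n k (suc q)) ⟩
    iter f (k % suc q + k / suc q * suc q) d             ≡⟨ iter-+ f (k % suc q) _ d ⟩
    iter f (k % suc q) (iter f (k / suc q * suc q) d)    ≡⟨ cong (iter f (k % suc q)) (iter-*-fixed f (suc q) eq (k / suc q)) ⟩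
    iter f (k % suc q) d ∎)
    where open ≡-Reasoning

  module _ (π : Permutation′ n) where

    private
      f : Fin n → Fin n
      f = π ⟨$⟩ʳ_

    perm-injective : ∀ {x y} → f x ≡ f y → x ≡ y
    perm-injective eq = trans (sym (inverseˡ π)) (trans (cong (π ⟨$⟩ˡ_) eq) (inverseˡ π))

    iter-injective : ∀ k {x y} → iter f k x ≡ iter f k y → x ≡ y
    iter-injective zero    eq = eq
    iter-injective (suc k) eq = iter-injective k (perm-injective eq)

    -- Pigeonhole on the first n + 1 iterates, followed by cancellation. The bound `suc q ≤ n`
    -- matters because `isRep` inspects only n iterates, which therefore exhaust the orbit.
    period : ∀ d → ∃[ q ] (suc q ≤ n × iter f (suc q) d ≡ d)
    period d with Fin.pigeonhole (ℕ.n<1+n n) (λ i → iter f (toℕ i) d)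
    ... | i , j , i<j , eq with ℕ.m≤n⇒∃[o]m+o≡n i<j
    ... | q , i+q≡j = q , q<n , iter-injective (toℕ i) (sym fixed)
      where
      i+q : toℕ i + suc q ≡ toℕ j
      i+q = trans (ℕ.+-suc (toℕ i) q) i+q≡j
      q<n : suc q ≤ n
      q<n = ℕ.≤-trans (ℕ.m≤n+m (suc q) (toℕ i))
              (ℕ.≤-trans (ℕ.≤-reflexive i+q) (ℕ.≤-pred (Fin.toℕ<n j)))
      fixed : iter f (toℕ i) d ≡ iter f (toℕ i) (iter f (suc q) d)
      fixed = trans eq (trans (cong (λ m → iter f m d) (sym i+q)) (iter-+ f (toℕ i) (suc q) d))

    SameOrbit-refl : ∀ {d} → SameOrbit π d d
    SameOrbit-refl = 0 , refl

    SameOrbit-step : ∀ d → SameOrbit π d (f d)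
    SameOrbit-step d = 1 , refl

    SameOrbit-trans : ∀ {d e g} → SameOrbit π d e → SameOrbit π e g → SameOrbit π d g
    SameOrbit-trans {d} (j , refl) (k , refl) = k + j , iter-+ f k j d

    SameOrbit-sym : ∀ {d e} → SameOrbit π d e → SameOrbit π e d
    SameOrbit-sym {d} (k , refl) with period d
    -- Going back k steps means going forward `k * q` steps, since `k * q + k` is k full turns of
    -- length `suc q`.
    ... | q , _ , eq = k * q , (begin
      iter f (k * q) (iter f k d) ≡⟨ sym (iter-+ f (k * q) k d) ⟩
      iter f (k * q + k) d        ≡⟨ cong (λ m → iter f m d) (trans (ℕ.+-comm (k * q) k) (sym (ℕ.*-suc k q))) ⟩
      iter f (k * suc q) d        ≡⟨ iter-*-fixed f (suc q) eq k ⟩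
      d ∎)
      where open ≡-Reasoning

    SameOrbit-isEquivalence : IsEquivalence (SameOrbit π)
    SameOrbit-isEquivalence = record
      { refl = SameOrbit-refl ; sym = SameOrbit-sym ; trans = SameOrbit-trans }

    SameOrbit⇒<n : ∀ {d e} → SameOrbit π d e → ∃[ k ] (k < n × iter f k d ≡ e)
    SameOrbit⇒<n {d} (k , refl) with period d
    ... | q , q<n , eq = k % suc q , ℕ.<-≤-trans (m%n<n k (suc q)) q<n , iter-% f q eq k

-- Orbit counts as lengths of lists of least representatives

and-map⁻ : {A : Set} (g : A → Bool) {xs : List A} → and (map g xs) ≡ true → ∀ {x} → x ∈ xs → g x ≡ true
and-map⁻ g {y ∷ ys} eq x∈ with g y in gy | x∈
... | true | here refl = gy
... | true | there p   = and-map⁻ g eq p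

and-map⁺ : {A : Set} (g : A → Bool) (xs : List A) → (∀ x → g x ≡ true) → and (map g xs) ≡ true
and-map⁺ g []       h = refl
and-map⁺ g (x ∷ xs) h = cong₂ _∧_ (h x) (and-map⁺ g xs h)

sum-indicator : {A : Set} (g : A → Bool) (xs : List A) →
  sum (map (λ d → if g d then 1 else 0) xs) ≡ length (filter (λ d → g d Bool.≟ true) xs)
sum-indicator g []       = refl
sum-indicator g (x ∷ xs) with g x
... | true  = cong suc (sum-indicator g xs)
... | false = sum-indicator g xs

module _ {n : ℕ} where

  reps : (Fin n → Fin n) → List (Fin n)
  reps f = filter (λ d → isRep f d Bool.≟ true) (allFin n)

  orbitCountF≡length-reps : (f : Fin n → Fin n) → orbitCountF f ≡ length (reps f)
  orbitCountF≡length-reps f = sum-indicator (isRep f) (allFin n)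

  isRep-minimal : (π : Permutation′ n) {d e : Fin n} →
    isRep (π ⟨$⟩ʳ_) d ≡ true → SameOrbit π d e → toℕ d ≤ toℕ e
  isRep-minimal π rep de with SameOrbit⇒<n π de
  ... | k , k<n , refl = ℕ.≤ᵇ⇒≤ _ _ (Equivalence.from Bool.T-≡ (and-map⁻ _ rep (∈-upTo⁺ k<n)))

  reps-distinct : (π : Permutation′ n) → AllPairs (λ d e → ¬ SameOrbit π d e) (reps (π ⟨$⟩ʳ_))
  reps-distinct π = go (All.all-filter _ (allFin n)) (Unique.filter⁺ _ (Unique.allFin⁺ n))
    where
    go : ∀ {xs} → All (λ d → isRep (π ⟨$⟩ʳ_) d ≡ true) xs → Unique xs → AllPairs (λ d e → ¬ SameOrbit π d e) xs
    go []       []       = []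
    go (r ∷ rs) (u ∷ us) = All.zipWith (λ (r′ , d≢e) de → d≢e (Fin.toℕ-injective
      (ℕ.≤-antisym (isRep-minimal π r de) (isRep-minimal π r′ (SameOrbit-sym π de))))) (rs , u) ∷ go rs us

-- Components by union–find

module _ {n : ℕ} where

  merge : (Fin n → Fin n) → Fin n → Fin n → Fin n → Fin n
  merge r x y d with r d Fin.≟ r x
  ... | yes _ = r y
  ... | no  _ = r d

  -- The labels decide the equivalence generated by the listed pairs. The list is processed from its
  -- tail, so in `l ++ base` the pairs of `l` are merged on top of the classes of `base`.
  classify : List (Fin n × Fin n) → Fin n → Fin n
  classify []            = id
  classify ((x , y) ∷ l) = merge (classify l) x y

  merge-cong : ∀ r x y {u v} → r u ≡ r v → merge r x y u ≡ merge r x y v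
  merge-cong r x y {u} {v} eq with r u Fin.≟ r x | r v Fin.≟ r x
  ... | yes _ | yes _ = refl
  ... | yes p | no q  = contradiction (trans (sym eq) p) q
  ... | no p  | yes q = contradiction (trans eq q) p
  ... | no _  | no _  = eq

  merge-joins : ∀ r x y → merge r x y x ≡ merge r x y y
  merge-joins r x y with r x Fin.≟ r x | r y Fin.≟ r x
  ... | yes _ | yes _ = refl
  ... | yes _ | no _  = refl
  ... | no p  | _     = contradiction refl p

  merge-other : ∀ r x y {u} → r u ≢ r x → merge r x y u ≡ r u
  merge-other r x y {u} u≢x with r u Fin.≟ r x
  ... | yes p = contradiction p u≢x
  ... | no _  = refl

  classify-complete : ∀ {l x y} → (x , y) ∈ l → classify l x ≡ classify l y
  classify-complete {(x , y) ∷ l} (here refl) = merge-joins (classify l) x y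
  classify-complete {(x , y) ∷ l} (there p)   = merge-cong (classify l) x y (classify-complete p)

  classify-++ : ∀ l {m u v} → classify m u ≡ classify m v → classify (l ++ m) u ≡ classify (l ++ m) v
  classify-++ []            eq = eq
  classify-++ ((x , y) ∷ l) {m} eq = merge-cong (classify (l ++ m)) x y (classify-++ l eq)

  module _ {R : Fin n → Fin n → Set} (R-isEquivalence : IsEquivalence R) where

    private module R = IsEquivalence R-isEquivalence

    -- Stated for an arbitrary equivalence containing the pairs, so that it applies directly to
    -- orbits and to `Conn` without constructing the generated relation.
    classify-sound : ∀ {l} → All (uncurry R) l → ∀ {x y} → classify l x ≡ classify l y → R x y
    classify-sound []                       eq = R.reflexive eq
    classify-sound {(a , b) ∷ l} (ab ∷ rs) {x} {y} eq
      with classify l x Fin.≟ classify l a | classify l y Fin.≟ classify l a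
    ... | yes p | yes q = classify-sound rs (trans p (sym q))
    ... | yes p | no  q = R.trans (classify-sound rs p) (R.trans ab (classify-sound rs eq))
    ... | no  p | yes q = R.sym (R.trans (classify-sound rs q) (R.trans ab (classify-sound rs (sym eq))))
    ... | no  p | no  q = classify-sound rs eq

  Separated : (Fin n → Fin n) → List (Fin n) → Set
  Separated r = AllPairs (λ x y → r x ≢ r y)

  separated-filter : ∀ r c xs → Separated r xs → length xs ≤ suc (length (filter (λ z → ¬? (r z Fin.≟ c)) xs))
  separated-filter r c []       []       = z≤n
  separated-filter r c (x ∷ xs) (p ∷ ps) with r x Fin.≟ c
  ... | no _     = s≤s (separated-filter r c xs ps)
  ... | yes refl = s≤s (ℕ.≤-reflexive (cong length (sym (filter-all (λ z → ¬? (r z Fin.≟ r x)) (All.map (_∘ sym) p)))))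

  -- A merge changes only the label `r x`, which at most one member of a separated list carries.
  -- Dropping that member keeps the others separated.
  separated-merge : ∀ r x y xs → Separated r xs → ∃[ ys ] (Separated (merge r x y) ys × length xs ≤ suc (length ys))
  separated-merge r x y xs sep =
    filter P? xs , go (All.all-filter P? xs) (AllPairs.filter⁺ P? sep) , separated-filter r (r x) xs sep
    where
    P? = λ z → ¬? (r z Fin.≟ r x)
    go : ∀ {ys} → All (λ z → r z ≢ r x) ys → Separated r ys → Separated (merge r x y) ys
    go []       []       = []
    go (q ∷ qs) (p ∷ ps) = All.zipWith
      (λ (q′ , u≢v) eq → u≢v (trans (sym (merge-other r x y q)) (trans eq (merge-other r x y q′)))) (qs , p) ∷ go qs ps

  separated-classify : ∀ l base xs → Separated (classify base) xs →
    ∃[ ys ] (Separated (classify (l ++ base)) ys × length xs ≤ length l + length ys)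
  separated-classify []            base xs sep = xs , sep , ℕ.≤-refl
  separated-classify ((x , y) ∷ l) base xs sep with separated-classify l base xs sep
  ... | ys , sep′ , le with separated-merge (classify (l ++ base)) x y ys sep′
  ... | zs , sep″ , le′ = zs , sep″ ,
    ℕ.≤-trans le (ℕ.≤-trans (ℕ.+-monoʳ-≤ (length l) le′) (ℕ.≤-reflexive (ℕ.+-suc (length l) (length zs))))

  -- Each pair lowers the number of classes by at most one. Applied to the vertices and to the
  -- faces, this gives the terms V - 1 and F - 1 in `bridge`.
  separated-bound : ∀ l base xs → Separated (classify base) xs →
    (∀ x y → classify (l ++ base) x ≡ classify (l ++ base) y) → length xs ≤ suc (length l)
  separated-bound l base xs sep one with separated-classify l base xs sep
  ... | []            , _               , le = ℕ.m≤n⇒m≤1+n (ℕ.≤-trans le (ℕ.≤-reflexive (ℕ.+-identityʳ _)))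
  ... | z ∷ []        , _               , le = ℕ.≤-trans le (ℕ.≤-reflexive (ℕ.+-comm (length l) 1))
  ... | z ∷ z′ ∷ zs   , ((p ∷ _) ∷ _)   , le = contradiction (one z z′) p

  orbitPairs : (Fin n → Fin n) → List (Fin n × Fin n)
  orbitPairs f = map (λ d → d , f d) (allFin n)

  orbitPairs-complete : ∀ f l d → classify (l ++ orbitPairs f) d ≡ classify (l ++ orbitPairs f) (f d)
  orbitPairs-complete f l d = classify-++ l (classify-complete (∈-map⁺ (λ d → d , f d) (∈-allFin d)))

  reps-separated : (π : Permutation′ n) → Separated (classify (orbitPairs (π ⟨$⟩ʳ_))) (reps (π ⟨$⟩ʳ_))
  reps-separated π = AllPairs.map
    (λ ¬same eq → ¬same (classify-sound (SameOrbit-isEquivalence π)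
      (All.map⁺ (All.universal (SameOrbit-step π) (allFin n))) eq)) (reps-distinct π)

  SameOrbit? : (π : Permutation′ n) → ∀ d e → Dec (SameOrbit π d e)
  SameOrbit? π d e = map′
    (classify-sound (SameOrbit-isEquivalence π) (All.map⁺ (All.universal (SameOrbit-step π) (allFin n))))
    (λ (k , eq) → along k eq)
    (classify l d Fin.≟ classify l e)
    where
    l = orbitPairs (π ⟨$⟩ʳ_)
    along : ∀ k {e} → iter (π ⟨$⟩ʳ_) k d ≡ e → classify l d ≡ classify l e
    along zero    refl = refl
    along (suc k) refl = trans (along k refl) (orbitPairs-complete (π ⟨$⟩ʳ_) [] _)

-- Duality between connectivity in a map and in its dual

sum-mono-≤ : ∀ {n} {f g : Fin n → ℕ} → (∀ d → f d ≤ g d) → Sum.sum f ≤ Sum.sum g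
sum-mono-≤ {zero}  f≤g = z≤n
sum-mono-≤ {suc n} f≤g = ℕ.+-mono-≤ (f≤g Fin.zero) (sum-mono-≤ (f≤g ∘ Fin.suc))

sum-mono-< : ∀ {n} {f g : Fin n → ℕ} → (∀ d → f d ≤ g d) → ∀ e → f e < g e → Sum.sum f < Sum.sum g
sum-mono-< f≤g Fin.zero    lt = ℕ.+-mono-<-≤ lt (sum-mono-≤ (f≤g ∘ Fin.suc))
sum-mono-< f≤g (Fin.suc e) lt = ℕ.+-mono-≤-< (f≤g Fin.zero) (sum-mono-< (f≤g ∘ Fin.suc) e lt)

both : Bool → Bool → ℕ
both a b = if a ∧ b then 1 else 0

-- This is (a - a′)(b - b′) ≥ 0 expanded over the naturals; the hypothesis makes the product vanish.
both-exchange : ∀ a a′ b b′ → a ≡ a′ ⊎ b ≡ b′ → both a b′ + both a′ b ≤ both a b + both a′ b′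
both-exchange a a′ b b′ (inj₁ refl) = ℕ.≤-reflexive (ℕ.+-comm (both a b′) (both a b))
both-exchange a a′ b b′ (inj₂ refl) = ℕ.≤-refl

not-true : ∀ {b} → not b ≡ true → b ≡ false
not-true {false} _ = refl

false≢true : ∀ {b} → b ≡ false → b ≢ true
false≢true refl ()

∨-inv : ∀ {a b} → a ∨ b ≡ true → a ≡ true ⊎ b ≡ true
∨-inv {true}  _  = inj₁ refl
∨-inv {false} eq = inj₂ eq

does-true : ∀ {P : Set} (P? : Dec P) → does P? ≡ true → P
does-true (yes p) _ = p

Star-sym : ∀ {A : Set} {R : A → A → Set} → (∀ {x y} → R x y → Star R y x) → ∀ {x y} → Star R x y → Star R y x
Star-sym rev ε       = ε
Star-sym rev (r ◅ s) = Star-sym rev s ◅◅ rev r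

module Duality {n : ℕ} (σ α : Permutation′ n) (α-inv : ∀ d → α ⟨$⟩ʳ (α ⟨$⟩ʳ d) ≡ d) where

  open Map σ α

  φₚ : Permutation′ n
  φₚ = α ∘ₚ σ

  Sym : (Fin n → Bool) → Set
  Sym S = ∀ d → S (α ⟨$⟩ʳ d) ≡ S d

  φα : ∀ d → φ (α ⟨$⟩ʳ d) ≡ σ ⟨$⟩ʳ d
  φα d = cong (σ ⟨$⟩ʳ_) (α-inv d)

  -- Conn σ A is connectivity in the graph with edge set A,
  -- Conn φₚ A is connectivity of faces across the edges of A.
  data Link (π : Permutation′ n) (S : Fin n → Bool) : Fin n → Fin n → Set where
    rot   : ∀ d → Link π S d (π ⟨$⟩ʳ d)
    cross : ∀ d → S d ≡ true → Link π S d (α ⟨$⟩ʳ d)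

  Conn : Permutation′ n → (Fin n → Bool) → Fin n → Fin n → Set
  Conn π S = Star (Link π S)

  module _ {R : Fin n → Fin n → Set} (R-refl : ∀ {d} → R d d) (R-trans : ∀ {d e g} → R d e → R e g → R d g) where

    Conn-fold : ∀ {π S} → (∀ d → R d (π ⟨$⟩ʳ d)) → (∀ d → S d ≡ true → R d (α ⟨$⟩ʳ d)) →
      ∀ {d e} → Conn π S d e → R d e
    Conn-fold r c = Star.fold R (λ { (rot d) s → R-trans (r d) s ; (cross d Sd) s → R-trans (c d Sd) s }) R-refl

  Conn-bind : ∀ {π S S′} → (∀ d → S d ≡ true → Conn π S′ d (α ⟨$⟩ʳ d)) → ∀ {d e} → Conn π S d e → Conn π S′ d e
  Conn-bind = Conn-fold ε _◅◅_ (λ d → rot d ◅ ε)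

  Conn-mono : ∀ {π S S′} → (∀ d → S d ≡ true → S′ d ≡ true) → ∀ {d e} → Conn π S d e → Conn π S′ d e
  Conn-mono S⊆S′ = Conn-bind (λ d Sd → cross d (S⊆S′ d Sd) ◅ ε)

  iter⇒Star : ∀ {R : Fin n → Fin n → Set} {f} → (∀ d → R d (f d)) → ∀ k {d e} → iter f k d ≡ e → Star R d e
  iter⇒Star r zero    refl = ε
  iter⇒Star r (suc k) refl = iter⇒Star r k refl ◅◅ (r _ ◅ ε)

  orbit⇒Conn : ∀ {π S d e} → SameOrbit π d e → Conn π S d e
  orbit⇒Conn (k , eq) = iter⇒Star rot k eq

  Conn-sym : ∀ {π S} → Sym S → ∀ {d e} → Conn π S d e → Conn π S e d
  Conn-sym {π} {S} symS = Star-sym λ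
    { (rot d)      → orbit⇒Conn (SameOrbit-sym π (SameOrbit-step π d))
    ; (cross d Sd) → subst (Conn π S (α ⟨$⟩ʳ d)) (α-inv d) (cross _ (trans (symS d) Sd) ◅ ε) }

  edgePairs : List (Fin n) → List (Fin n × Fin n)
  edgePairs = map (λ d → d , α ⟨$⟩ʳ d)

  Conn? : ∀ π S → Sym S → ∀ x y → Dec (Conn π S x y)
  Conn? π S symS x y = map′
    (classify-sound (record { refl = ε ; sym = Conn-sym symS ; trans = _◅◅_ })
      (All.++⁺ (All.map⁺ (All.map (λ Sd → cross _ Sd ◅ ε) (All.all-filter S? (allFin n))))
               (All.map⁺ (All.universal (λ d → rot d ◅ ε) (allFin n)))))
    (Conn-fold {R = λ u v → classify l u ≡ classify l v} refl trans (orbitPairs-complete _ (edgePairs es))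
      (λ d Sd → classify-complete (∈-++⁺ˡ (∈-map⁺ _ (∈-filter⁺ S? (∈-allFin d) Sd)))))
    (classify l x Fin.≟ classify l y)
    where
    S? = λ d → S d Bool.≟ true
    es = filter S? (allFin n)
    l = edgePairs es ++ orbitPairs (π ⟨$⟩ʳ_)

  -- The form Σ_d (κ d − κ (α d)) (χ d − χ (α d)) vanishes when κ is a function of the
  -- vertex and χ a function of the face (cuts and boundaries are orthogonal);
  -- below, the products are expanded and the negative ones moved to the other side.
  orthogonality : (κ χ : Fin n → Bool) →
    (∀ d → κ (σ ⟨$⟩ʳ d) ≡ κ d) → (∀ d → χ (φ d) ≡ χ d) →
    ∀ e → κ e ≡ true → κ (α ⟨$⟩ʳ e) ≡ false → χ e ≡ true → χ (α ⟨$⟩ʳ e) ≡ false →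
    ¬ (∀ d → d ≢ e → d ≢ α ⟨$⟩ʳ e → κ d ≡ κ (α ⟨$⟩ʳ d) ⊎ χ d ≡ χ (α ⟨$⟩ʳ d))
  orthogonality κ χ κσ χφ e κe καe χe χαe agree = ℕ.<-irrefl (trans sum-mixed (sym sum-pure)) (sum-mono-< le e lt)
    where
    a : Fin n → Fin n
    a = α ⟨$⟩ʳ_
    pure mixed : Fin n → ℕ
    pure  d = both (κ d) (χ d) + both (κ (a d)) (χ (a d))
    mixed d = both (κ d) (χ (a d)) + both (κ (a d)) (χ d)
    P Q : ℕ
    P = Sum.sum (λ d → both (κ d) (χ d))
    Q = Sum.sum (λ d → both (κ d) (χ (a d)))
    -- The reverse of `d` lies on the face of `σ d`, a dart at the same vertex as `d`; reindexing by
    -- σ therefore turns the mixed sum Q into P.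
    χα : ∀ d → χ (a d) ≡ χ (σ ⟨$⟩ʳ d)
    χα d = trans (sym (χφ (a d))) (cong χ (φα d))
    Q≡P : Q ≡ P
    Q≡P = trans (Sum.sum-cong-≗ (λ d → cong₂ both (sym (κσ d)) (χα d)))
                (sym (Sum.sum-permute (λ d → both (κ d) (χ d)) σ))
    sum-pure : Sum.sum pure ≡ P + P
    sum-pure = trans (Sum.∑-distrib-+ (λ d → both (κ d) (χ d)) (λ d → both (κ (a d)) (χ (a d))))
      (cong (P +_) (sym (Sum.sum-permute (λ d → both (κ d) (χ d)) α)))
    sum-mixed : Sum.sum mixed ≡ P + P
    sum-mixed = trans (Sum.∑-distrib-+ (λ d → both (κ d) (χ (a d))) (λ d → both (κ (a d)) (χ d)))
      (cong₂ _+_ Q≡P (trans (Sum.sum-cong-≗ (λ d → cong (both (κ (a d))) (cong χ (sym (α-inv d)))))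
        (trans (sym (Sum.sum-permute (λ d → both (κ d) (χ (a d))) α)) Q≡P)))
    -- The product is +1 at `e` and again at its reverse dart, so the two contributions cannot
    -- cancel.
    lt : mixed e < pure e
    lt rewrite κe | καe | χe | χαe = s≤s z≤n
    le : ∀ d → mixed d ≤ pure d
    le d with d Fin.≟ e | d Fin.≟ a e
    ... | yes refl | _        = ℕ.<⇒≤ lt
    ... | no _     | yes refl rewrite α-inv e | κe | καe | χe | χαe = z≤n
    ... | no d≢e   | no d≢αe  = both-exchange (κ d) (κ (a d)) (χ d) (χ (a d)) (agree d d≢e d≢αe)

  -- The half of duality that needs no Euler formula: if both walks failed, the component of `e`
  -- under `A` and the face component of `e` under `U` would give functions κ and χ of which at
  -- least one is constant across every other edge.
  dichotomy : ∀ A U → Sym A → Sym U → ∀ e →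
    (∀ d → d ≢ e → d ≢ α ⟨$⟩ʳ e → A d ≡ true ⊎ U d ≡ true) →
    Conn σ A e (α ⟨$⟩ʳ e) ⊎ Conn φₚ U e (α ⟨$⟩ʳ e)
  dichotomy A U symA symU e cover with Conn? σ A symA e (α ⟨$⟩ʳ e) | Conn? φₚ U symU e (α ⟨$⟩ʳ e)
  ... | yes p | _     = inj₁ p
  ... | no _  | yes q = inj₂ q
  ... | no ¬p | no ¬q = ⊥-elim (orthogonality κ χ
    (λ d → sym (step σ A symA (rot d))) (λ d → sym (step φₚ U symU (rot d))) e
    (dec-true (Conn? σ A symA e e) ε) (dec-false (Conn? σ A symA e _) ¬p)
    (dec-true (Conn? φₚ U symU e e) ε) (dec-false (Conn? φₚ U symU e _) ¬q)
    (λ d d≢e d≢αe → ⊎.map (λ Ad → step σ A symA (cross d Ad)) (λ Ud → step φₚ U symU (cross d Ud)) (cover d d≢e d≢αe)))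
    where
    κ χ : Fin n → Bool
    κ d = does (Conn? σ A symA e d)
    χ d = does (Conn? φₚ U symU e d)
    step : ∀ π S (symS : Sym S) {x y} → Link π S x y → does (Conn? π S symS e x) ≡ does (Conn? π S symS e y)
    step π S symS l = does-⇔ (mk⇔ (_◅◅ (l ◅ ε)) (_◅◅ Conn-sym symS (l ◅ ε)))
      (Conn? π S symS e _) (Conn? π S symS e _)

  -- Spanning forests and the counting half of duality

  open DecMembership (Fin._≟_ {n}) using (_∈?_)

  edgeIn : List (Fin n) → Fin n → Bool
  edgeIn l d = does (d ∈? l) ∨ does ((α ⟨$⟩ʳ d) ∈? l)

  edgeIn-sym : ∀ l → Sym (edgeIn l)
  edgeIn-sym l d rewrite α-inv d = Bool.∨-comm (does ((α ⟨$⟩ʳ d) ∈? l)) _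

  edgeIn⁻ : ∀ l d → edgeIn l d ≡ true → d ∈ l ⊎ (α ⟨$⟩ʳ d) ∈ l
  edgeIn⁻ l d eq = ⊎.map (does-true (d ∈? l)) (does-true (_ ∈? l)) (∨-inv eq)

  edgeIn⁺ : ∀ l d → d ∈ l ⊎ (α ⟨$⟩ʳ d) ∈ l → edgeIn l d ≡ true
  edgeIn⁺ l d (inj₁ p) rewrite dec-true (d ∈? l) p = refl
  edgeIn⁺ l d (inj₂ p) rewrite dec-true ((α ⟨$⟩ʳ d) ∈? l) p = Bool.∨-zeroʳ _

  not-sym : ∀ {S} → Sym S → Sym (not ∘ S)
  not-sym symS d = cong not (symS d)

  -- tree is a maximal forest in es ∩ B; that it is acyclic is recorded only through coconn.
  record Forest (B : Fin n → Bool) (es : List (Fin n)) : Set where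
    field
      tree rest : List (Fin n)
      size      : length tree + length rest ≡ length es
      split     : ∀ {x} → x ∈ es → x ∈ tree ⊎ x ∈ rest
      tree⊆B    : ∀ {x} → x ∈ tree → B x ≡ true
      spans     : ∀ {x} → x ∈ es → B x ≡ true → Conn σ (edgeIn tree) x (α ⟨$⟩ʳ x)
      coconn    : ∀ d → Conn φₚ (not ∘ edgeIn tree) d (α ⟨$⟩ʳ d)

  -- Kruskal's greedy choice. When x enters the tree, the old tree did not join its ends, so
  -- `dichotomy` leads around x in the dual without crossing the new tree; `back` reroutes along
  -- this detour every dual walk that crossed x.
  forest : ∀ B es → Forest B es
  forest B [] = record
    { tree = [] ; rest = [] ; size = refl ; split = λ () ; tree⊆B = λ () ; spans = λ ()
    ; coconn = λ d → cross d refl ◅ ε }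
  forest B (x ∷ es) with forest B es
  ... | F with B x in Bx | Conn? σ (edgeIn (Forest.tree F)) (edgeIn-sym (Forest.tree F)) x (α ⟨$⟩ʳ x)
  ... | false | _ = record
    { tree = tree ; rest = x ∷ rest ; size = trans (ℕ.+-suc _ _) (cong suc size)
    ; split = λ { (here refl) → inj₂ (here refl) ; (there p) → ⊎.map₂ there (split p) }
    ; tree⊆B = tree⊆B
    ; spans = λ { (here refl) Bx′ → contradiction Bx′ (false≢true Bx) ; (there p) → spans p }
    ; coconn = coconn }
    where
    open Forest F
  ... | true | yes c = record
    { tree = tree ; rest = x ∷ rest ; size = trans (ℕ.+-suc _ _) (cong suc size)
    ; split = λ { (here refl) → inj₂ (here refl) ; (there p) → ⊎.map₂ there (split p) }
    ; tree⊆B = tree⊆B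
    ; spans = λ { (here refl) _ → c ; (there p) → spans p }
    ; coconn = coconn }
    where
    open Forest F
  ... | true | no ¬c = record
    { tree = x ∷ tree ; rest = rest ; size = cong suc size
    ; split = λ { (here refl) → inj₁ (here refl) ; (there p) → ⊎.map₁ there (split p) }
    ; tree⊆B = λ { (here refl) → Bx ; (there p) → tree⊆B p }
    ; spans = λ { (here refl) _ → cross x (edgeIn⁺ (x ∷ tree) x (inj₁ (here refl))) ◅ ε
                ; (there p) By → Conn-mono grow (spans p By) }
    ; coconn = λ d → Conn-bind back (coconn d) }
    where
    open Forest F
    a = α ⟨$⟩ʳ_
    tree′ = x ∷ tree
    grow : ∀ d → edgeIn tree d ≡ true → edgeIn tree′ d ≡ true
    grow d p = edgeIn⁺ tree′ d (⊎.map there there (edgeIn⁻ tree d p))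
    stays : ∀ d → d ≢ x → d ≢ a x → edgeIn tree d ≡ false → not (edgeIn tree′ d) ≡ true
    stays d d≢x d≢αx ∉tree with edgeIn tree′ d in eq
    ... | false = refl
    ... | true with edgeIn⁻ tree′ d eq
    ... | inj₁ (here d≡x)   = contradiction d≡x d≢x
    ... | inj₁ (there p)    = contradiction (edgeIn⁺ tree d (inj₁ p)) (false≢true ∉tree)
    ... | inj₂ (here αd≡x)  = contradiction (trans (sym (α-inv d)) (cong a αd≡x)) d≢αx
    ... | inj₂ (there p)    = contradiction (edgeIn⁺ tree d (inj₂ p)) (false≢true ∉tree)
    co-sym : Sym (not ∘ edgeIn tree′)
    co-sym = not-sym (edgeIn-sym tree′)
    around : Conn φₚ (not ∘ edgeIn tree′) x (a x)
    around with dichotomy (edgeIn tree) (not ∘ edgeIn tree′) (edgeIn-sym tree) co-sym x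
      (λ d d≢x d≢αx → alt d d≢x d≢αx)
      where
      alt : ∀ d → d ≢ x → d ≢ a x → edgeIn tree d ≡ true ⊎ not (edgeIn tree′ d) ≡ true
      alt d d≢x d≢αx with edgeIn tree d in eq
      ... | true  = inj₁ refl
      ... | false = inj₂ (stays d d≢x d≢αx eq)
    ... | inj₁ c = contradiction c ¬c
    ... | inj₂ c = c
    back : ∀ d → not (edgeIn tree d) ≡ true → Conn φₚ (not ∘ edgeIn tree′) d (a d)
    back d nd with d Fin.≟ x | d Fin.≟ a x
    ... | yes refl | _        = around
    ... | no _     | yes refl = Conn-sym co-sym (subst (λ y → Conn φₚ (not ∘ edgeIn tree′) y (a x)) (sym (α-inv x)) around)
    ... | no d≢x   | no d≢αx  = cross d (stays d d≢x d≢αx (not-true nd)) ◅ ε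

  iter-α : ∀ k d → iter (α ⟨$⟩ʳ_) k d ≡ d ⊎ iter (α ⟨$⟩ʳ_) k d ≡ α ⟨$⟩ʳ d
  iter-α zero    d = inj₁ refl
  iter-α (suc k) d with iter-α k d
  ... | inj₁ eq = inj₂ (cong (α ⟨$⟩ʳ_) eq)
  ... | inj₂ eq = inj₁ (trans (cong (α ⟨$⟩ʳ_) eq) (α-inv d))

  edges : List (Fin n)
  edges = reps (α ⟨$⟩ʳ_)

  ≤⇒∈edges : ∀ d → toℕ d ≤ toℕ (α ⟨$⟩ʳ d) → d ∈ edges
  ≤⇒∈edges d d≤αd = ∈-filter⁺ _ (∈-allFin d) (and-map⁺ _ (upTo n) (λ k → Equivalence.to Bool.T-≡ (ℕ.≤⇒≤ᵇ (below k))))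
    where
    below : ∀ k → toℕ d ≤ toℕ (iter (α ⟨$⟩ʳ_) k d)
    below k with iter-α k d
    ... | inj₁ eq = ℕ.≤-reflexive (cong toℕ (sym eq))
    ... | inj₂ eq = ℕ.≤-trans d≤αd (ℕ.≤-reflexive (cong toℕ (sym eq)))

  edges-cover : ∀ d → d ∈ edges ⊎ (α ⟨$⟩ʳ d) ∈ edges
  edges-cover d with ℕ.≤-total (toℕ d) (toℕ (α ⟨$⟩ʳ d))
  ... | inj₁ le = inj₁ (≤⇒∈edges d le)
  ... | inj₂ le = inj₂ (≤⇒∈edges _ (ℕ.≤-trans le (ℕ.≤-reflexive (cong toℕ (sym (α-inv d))))))

  -- If a non-edge e of B could be bypassed in the dual, then a spanning tree of B and the
  -- remaining dual edges without e would give V − 1 + F − 1 ≤ E − 1 edges, against Euler's formula.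
  bridge : (∀ d e → Star MStep d e) → orbitCount σ + orbitCountF φ ≡ orbitCount α + 2 →
    ∀ B → Sym B → (∀ d e → Conn σ B d e) →
    ∀ U e → B e ≡ false → (∀ d → U d ≡ true → B d ≡ false × d ≢ e × d ≢ α ⟨$⟩ʳ e) →
    ¬ Conn φₚ U e (α ⟨$⟩ʳ e)
  bridge connected euler B symB Bconn U e Be Uprop around = ℕ.<-irrefl refl (begin-strict
      length edges + 1                                    ≡⟨ ℕ.+-comm (length edges) 1 ⟩
      suc (length edges)                                  <⟨ ℕ.n<1+n _ ⟩
      2 + length edges                                    ≡⟨ ℕ.+-comm 2 (length edges) ⟩
      length edges + 2                                    ≡⟨ cong (_+ 2) (sym (orbitCountF≡length-reps (α ⟨$⟩ʳ_))) ⟩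
      orbitCount α + 2                                    ≡⟨ sym euler ⟩
      orbitCount σ + orbitCountF φ                        ≡⟨ cong₂ _+_ (orbitCountF≡length-reps (σ ⟨$⟩ʳ_)) (orbitCountF≡length-reps φ) ⟩
      length (reps (σ ⟨$⟩ʳ_)) + length (reps φ)           ≤⟨ ℕ.+-mono-≤ V-bound F-bound ⟩
      suc (length tree) + length rest                     ≡⟨ cong suc size ⟩
      suc (length edges)                                  ≡⟨ ℕ.+-comm 1 (length edges) ⟩
      length edges + 1                                    ∎)
    where
    open ℕ.≤-Reasoning
    open Forest (forest B edges)
    a = α ⟨$⟩ʳ_
    V-bound : length (reps (σ ⟨$⟩ʳ_)) ≤ suc (length tree)
    V-bound = ℕ.≤-trans
      (separated-bound (edgePairs tree) _ _ (reps-separated σ) (λ x y → onB (Bconn x y)))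
      (ℕ.≤-reflexive (cong suc (length-map _ tree)))
      where
      l = edgePairs tree ++ orbitPairs (σ ⟨$⟩ʳ_)
      E : Fin n → Fin n → Set
      E u v = classify l u ≡ classify l v
      onTree : ∀ {x y} → Conn σ (edgeIn tree) x y → E x y
      onTree = Conn-fold {R = E} refl trans (orbitPairs-complete _ (edgePairs tree)) λ d p →
        [ (λ q → classify-complete (∈-++⁺ˡ (∈-map⁺ _ q)))
        , (λ q → subst (λ z → E z (a d)) (α-inv d) (sym (classify-complete (∈-++⁺ˡ (∈-map⁺ _ q))))) ]′ (edgeIn⁻ tree d p)
      onB : ∀ {x y} → Conn σ B x y → E x y
      onB = Conn-fold {R = E} refl trans (orbitPairs-complete _ (edgePairs tree)) λ d Bd →
        [ (λ q → onTree (spans q Bd))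
        , (λ q → subst (λ z → E z (a d)) (α-inv d) (sym (onTree (spans q (trans (symB d) Bd))))) ]′ (edges-cover d)
    ∉tree : ∀ d → edgeIn tree d ≡ false → d ∈ rest ⊎ a d ∈ rest
    ∉tree d p with edges-cover d
    ... | inj₁ q = [ (λ r → contradiction (edgeIn⁺ tree d (inj₁ r)) (false≢true p)) , inj₁ ]′ (split q)
    ... | inj₂ q = [ (λ r → contradiction (edgeIn⁺ tree d (inj₂ r)) (false≢true p)) , inj₂ ]′ (split q)
    ∉B : ∀ d → B d ≡ false → d ∈ rest ⊎ a d ∈ rest
    ∉B d Bd with edgeIn tree d in eq
    ... | false = ∉tree d eq
    ... | true  = ⊥-elim ([ (λ q → false≢true Bd (tree⊆B q))
                          , (λ q → false≢true Bd (trans (sym (symB d)) (tree⊆B q))) ]′ (edgeIn⁻ tree d eq))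
    e* : ∃[ x ] (x ∈ rest × (x ≡ e ⊎ x ≡ a e))
    e* = [ (λ q → e , q , inj₁ refl) , (λ q → a e , q , inj₂ refl) ]′ (∉B e Be)
    x* : Fin n
    x* = proj₁ e*
    ≢x*? : (x : Fin n) → Dec (x ≢ x*)
    ≢x*? x = ¬? (x Fin.≟ x*)
    -- The listed dart of `e` is dropped from the non-tree edges. They still connect all faces,
    -- because `U` leads around `e`; this saves the one edge that contradicts Euler's formula.
    rest′ : List (Fin n)
    rest′ = filter ≢x*? rest
    rest′-shorter : suc (length rest′) ≤ length rest
    rest′-shorter = filter-notAll ≢x*? rest (lose (proj₁ (proj₂ e*)) (λ f → f refl))
    F-bound : length (reps φ) ≤ length rest
    F-bound = ℕ.≤-trans
      (separated-bound (edgePairs rest′) _ _ (reps-separated φₚ) (λ x y → everywhere (connected x y)))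
      (ℕ.≤-trans (ℕ.≤-reflexive (cong suc (length-map _ rest′))) rest′-shorter)
      where
      l = edgePairs rest′ ++ orbitPairs φ
      E : Fin n → Fin n → Set
      E u v = classify l u ≡ classify l v
      flip-E : ∀ {d} → E (a d) (a (a d)) → E d (a d)
      flip-E {d} p = subst (λ z → E z (a d)) (α-inv d) (sym p)
      onRest : ∀ {d} → d ∈ rest → d ≢ x* → E d (a d)
      onRest q d≢ = classify-complete (∈-++⁺ˡ (∈-map⁺ _ (∈-filter⁺ ≢x*? q d≢)))
      rotE : ∀ d → E d (φ d)
      rotE = orbitPairs-complete φ (edgePairs rest′)
      avoid : ∀ d → d ≢ e → d ≢ a e → d ≢ x* × a d ≢ x*
      avoid d d≢e d≢αe with proj₂ (proj₂ e*)
      ... | inj₁ x≡e  = (λ p → d≢e (trans p x≡e)) , (λ p → d≢αe (trans (sym (α-inv d)) (cong a (trans p x≡e))))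
      ... | inj₂ x≡αe = (λ p → d≢αe (trans p x≡αe)) , (λ p → d≢e (perm-injective α (trans p x≡αe)))
      onU : ∀ {x y} → Conn φₚ U x y → E x y
      onU = Conn-fold {R = E} refl trans rotE λ d Ud → let Bd , d≢e , d≢αe = Uprop d Ud in
        [ (λ q → onRest q (proj₁ (avoid d d≢e d≢αe)))
        , (λ q → flip-E (onRest q (proj₂ (avoid d d≢e d≢αe)))) ]′ (∉B d Bd)
      onE : ∀ d → d ≡ e ⊎ d ≡ a e → E d (a d)
      onE d (inj₁ refl) = onU around
      onE d (inj₂ refl) = flip-E (subst (λ z → E z (a z)) (sym (α-inv e)) (onU around))
      onCotree : ∀ {x y} → Conn φₚ (not ∘ edgeIn tree) x y → E x y
      onCotree = Conn-fold {R = E} refl trans rotE step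
        where
        step : ∀ d → not (edgeIn tree d) ≡ true → E d (a d)
        step d p with d Fin.≟ e | d Fin.≟ a e
        ... | yes q | _     = onE d (inj₁ q)
        ... | no _  | yes q = onE d (inj₂ q)
        ... | no d≢e | no d≢αe = [ (λ q → onRest q (proj₁ (avoid d d≢e d≢αe)))
          , (λ q → flip-E (onRest q (proj₂ (avoid d d≢e d≢αe)))) ]′ (∉tree d (not-true p))
      everywhere : ∀ {x y} → Star MStep x y → E x y
      everywhere = Star.fold E (λ
        { (viaα d) s → trans (onCotree (coconn d)) s
        ; (viaσ d) s → trans (onCotree (coconn d)) (trans (trans (rotE (a d)) (cong (classify l) (φα d))) s) }) refl

-- Closed trails as lists

least : {P : ℕ → Set} → (∀ k → Dec (P k)) → ∀ m → P m → ∃[ k ] (P k × (∀ {j} → j < k → ¬ P j))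
least P? zero    Pm = 0 , Pm , λ ()
least P? (suc m) Pm with P? 0
... | yes P0 = 0 , P0 , λ ()
... | no ¬P0 with least (P? ∘ suc) m Pm
... | k , Pk , min = suc k , Pk , λ { {zero} _ → ¬P0 ; {suc j} (s≤s lt) → min lt }

-- Minimality of the period is what keeps the trail read off an orbit from traversing a dart twice.
minimal-period : ∀ {n} (π : Permutation′ n) d → let g = λ i → iter (π ⟨$⟩ʳ_) i d in
  ∃[ q ] (g (suc q) ≡ d × Unique (applyUpTo g (suc q)))
minimal-period π d with period π d
... | m , _ , eq with least (λ j → iter (π ⟨$⟩ʳ_) (suc j) d Fin.≟ d) m eq
... | q , closes , min = q , closes , Unique.applyUpTo⁺₁ (λ i → iter (π ⟨$⟩ʳ_) i d) (suc q) distinct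
  where
  distinct : ∀ {i j} → i < j → j < suc q → iter (π ⟨$⟩ʳ_) i d ≢ iter (π ⟨$⟩ʳ_) j d
  distinct {i} {j} i<j j≤q eq with ℕ.m≤n⇒∃[o]m+o≡n i<j
  ... | r , i+r≡j = min r<q (sym (iter-injective π i
        (trans eq (trans (cong (λ m → iter (π ⟨$⟩ʳ_) m d) (sym j≡)) (iter-+ (π ⟨$⟩ʳ_) i (suc r) d)))))
    where
    j≡ : i + suc r ≡ j
    j≡ = trans (ℕ.+-suc i r) i+r≡j
    r<q : r < q
    r<q = ℕ.≤-trans (ℕ.m≤n+m (suc r) i) (ℕ.≤-trans (ℕ.≤-reflexive j≡) (ℕ.≤-pred j≤q))

consecutive : {A : Set} → A → List A → List (A × A)
consecutive x []       = []
consecutive x (y ∷ ys) = (x , y) ∷ consecutive y ys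

consecutive-firsts : {A : Set} (x : A) (xs : List A) (z : A) → map proj₁ (consecutive x (xs ++ [ z ])) ≡ x ∷ xs
consecutive-firsts x []       z = refl
consecutive-firsts x (y ∷ ys) z = cong (x ∷_) (consecutive-firsts y ys z)

consecutive-seconds : {A : Set} (x : A) (ys : List A) → map proj₂ (consecutive x ys) ≡ ys
consecutive-seconds x []       = refl
consecutive-seconds x (y ∷ ys) = cong (y ∷_) (consecutive-seconds y ys)

-- Serves to recover a step of a trail from its first dart alone, or from its second, since no dart
-- is repeated.
Unique-map⇒injective : {A B : Set} (f : A → B) {l : List A} → Unique (map f l) →
  ∀ {p q} → p ∈ l → q ∈ l → f p ≡ f q → p ≡ q
Unique-map⇒injective f {_ ∷ _} (u ∷ us) (here refl) (here refl) _ = refl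
Unique-map⇒injective f {_ ∷ _} (u ∷ us) (here refl) (there q∈) eq =
  contradiction eq (All.lookup u (∈-map⁺ f q∈))
Unique-map⇒injective f {_ ∷ _} (u ∷ us) (there p∈) (here refl) eq =
  contradiction (sym eq) (All.lookup u (∈-map⁺ f p∈))
Unique-map⇒injective f {_ ∷ _} (u ∷ us) (there p∈) (there q∈) eq = Unique-map⇒injective f us p∈ q∈ eq

Unique-rotate : {A : Set} {x : A} {xs : List A} → Unique (x ∷ xs) → Unique (xs ++ [ x ])
Unique-rotate (u ∷ us) = Unique.++⁺ us ([] ∷ []) λ { (p , here refl) → All.lookup u p refl }

-- Colours at a cubic vertex

_≟c_ : (x y : Color) → Dec (x ≡ y)
c1 ≟c c1 = yes refl
c1 ≟c c2 = no λ ()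
c1 ≟c c3 = no λ ()
c2 ≟c c1 = no λ ()
c2 ≟c c2 = yes refl
c2 ≟c c3 = no λ ()
c3 ≟c c1 = no λ ()
c3 ≟c c2 = no λ ()
c3 ≟c c3 = yes refl

allColors? : {P : Color → Set} → (∀ c → Dec (P c)) → Dec (∀ c → P c)
allColors? P? = map′ (λ { (p , q , r) → λ { c1 → p ; c2 → q ; c3 → r } }) (λ f → f c1 , f c2 , f c3)
  (P? c1 ×-dec (P? c2 ×-dec P? c3))

abstract
  color-cover : (x y z : Color) → x ≢ y → y ≢ z → x ≢ z → ∀ c → c ≡ x ⊎ c ≡ y ⊎ c ≡ z
  color-cover = from-yes (allColors? λ x → allColors? λ y → allColors? λ z →
    ¬? (x ≟c y) →-dec (¬? (y ≟c z) →-dec (¬? (x ≟c z) →-dec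
    allColors? λ c → (c ≟c x) ⊎-dec ((c ≟c y) ⊎-dec (c ≟c z)))))

-- Exchanges the two colours that may be contracted. The value at `c1` is a default, excluded
-- wherever it is used by `k ≢ c1`.
other : Color → Color
other c1 = c1
other c2 = c3
other c3 = c2

other-props : ∀ k → k ≢ c1 → other k ≢ k × other k ≢ c1
other-props c1 k≢ = contradiction refl k≢
other-props c2 _  = (λ ()) , (λ ())
other-props c3 _  = (λ ()) , (λ ())

xor-cancelʳ : ∀ s b → (s xor b) xor b ≡ s
xor-cancelʳ s b = trans (Bool.xor-assoc s b b) (trans (cong (s xor_) (Bool.xor-same b)) (Bool.xor-identityʳ s))

xor≡false : ∀ {a b} → a xor b ≡ false → a ≡ b
xor≡false {true}  {true}  _ = refl
xor≡false {false} {false} _ = refl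

xor≡true : ∀ {a b} → a xor b ≡ true → a ≡ true ⊎ b ≡ true
xor≡true {true}  _  = inj₁ refl
xor≡true {false} eq = inj₂ eq

∧-inv : ∀ {a b} → a ∧ b ≡ true → a ≡ true × b ≡ true
∧-inv {true} {true} _ = refl , refl

∧-intro : ∀ {a b} → a ≡ true → b ≡ true → a ∧ b ≡ true
∧-intro refl refl = refl

module Coloured {n : ℕ} (σ α : Permutation′ n) (col : Fin n → Color)
  (plane : Map.IsPlaneMap σ α) (simple : Map.Simple σ α) (cubic : Map.Cubic σ α)
  (proper : Map.ProperFaceColoring σ α col) where

  open Map σ α

  α-inv : ∀ d → α ⟨$⟩ʳ (α ⟨$⟩ʳ d) ≡ d
  α-inv = proj₁ plane

  open Duality σ α α-inv

  s a : Fin n → Fin n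
  s = σ ⟨$⟩ʳ_
  a = α ⟨$⟩ʳ_

  σ³ : ∀ d → s (s (s d)) ≡ d
  σ³ d = proj₂ (proj₂ (cubic d))

  SameV-refl : ∀ {d} → SameV d d
  SameV-refl = SameOrbit-refl σ

  SameV-sym : ∀ {d e} → SameV d e → SameV e d
  SameV-sym = SameOrbit-sym σ

  SameV-trans : ∀ {d e g} → SameV d e → SameV e g → SameV d g
  SameV-trans = SameOrbit-trans σ

  SameF-sym : ∀ {d e} → SameF d e → SameF e d
  SameF-sym = SameOrbit-sym φₚ

  SameF-trans : ∀ {d e g} → SameF d e → SameF e g → SameF d g
  SameF-trans = SameOrbit-trans φₚ

  SameV-σ : ∀ {d} → SameV d (s d)
  SameV-σ = 1 , refl

  SameV-σσ : ∀ {d} → SameV d (s (s d))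
  SameV-σσ = 2 , refl

  SameF-φ : ∀ {d} → SameF d (φ d)
  SameF-φ = 1 , refl

  SameF-ασ : ∀ {d} → SameF (a d) (s d)
  SameF-ασ {d} = 1 , φα d

  SameV-cases : ∀ {d e} → SameV d e → e ≡ d ⊎ e ≡ s d ⊎ e ≡ s (s d)
  SameV-cases (zero  , refl) = inj₁ refl
  SameV-cases (suc k , refl) with SameV-cases (k , refl)
  ... | inj₁ eq        = inj₂ (inj₁ (cong s eq))
  ... | inj₂ (inj₁ eq) = inj₂ (inj₂ (cong s eq))
  ... | inj₂ (inj₂ eq) = inj₁ (trans (cong s eq) (σ³ _))

  col-α≢ : ∀ d → col (a d) ≢ col d
  col-α≢ = proj₂ proper

  col-SameF : ∀ {d e} → SameF d e → col d ≡ col e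
  col-SameF (zero  , refl) = refl
  col-SameF (suc k , refl) = trans (col-SameF (k , refl)) (sym (proj₁ proper _))

  col-ασ : ∀ d → col (a d) ≡ col (s d)
  col-ασ d = col-SameF SameF-ασ

  col-σ≢ : ∀ d → col (s d) ≢ col d
  col-σ≢ d eq = col-α≢ d (trans (col-ασ d) eq)

  col-σσ≢ : ∀ d → col (s (s d)) ≢ col d
  col-σσ≢ d eq = col-σ≢ (s (s d)) (trans (cong col (σ³ d)) (sym eq))

  SameV-col : ∀ {d e} → SameV d e → col d ≡ col e → e ≡ d
  SameV-col v eq with SameV-cases v
  ... | inj₁ p           = p
  ... | inj₂ (inj₁ refl) = contradiction (sym eq) (col-σ≢ _)
  ... | inj₂ (inj₂ refl) = contradiction (sym eq) (col-σσ≢ _)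

  has-color : ∀ c d → c ≡ col d ⊎ c ≡ col (s d) ⊎ c ≡ col (s (s d))
  has-color c d = color-cover (col d) (col (s d)) (col (s (s d)))
    (col-σ≢ d ∘ sym) (col-σ≢ (s d) ∘ sym) (col-σσ≢ d ∘ sym) c

  abstract
    at-exists : ∀ c d → ∃[ e ] (SameV d e × col e ≡ c)
    at-exists c d with has-color c d
    ... | inj₁ p        = d , SameV-refl , sym p
    ... | inj₂ (inj₁ p) = s d , SameV-σ , sym p
    ... | inj₂ (inj₂ p) = s (s d) , SameV-σσ , sym p

  -- The three darts at a vertex lie on faces of three different colours, so `at k d` stands for the
  -- k-face through the vertex of `d`.
  at : Color → Fin n → Fin n
  at c d = proj₁ (at-exists c d)

  at-SameV : ∀ c d → SameV d (at c d)
  at-SameV c d = proj₁ (proj₂ (at-exists c d))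

  at-col : ∀ c d → col (at c d) ≡ c
  at-col c d = proj₂ (proj₂ (at-exists c d))

  at-unique : ∀ {c d e} → SameV d e → col e ≡ c → at c d ≡ e
  at-unique {c} {d} v eq = SameV-col (SameV-trans (SameV-sym v) (at-SameV c d)) (trans eq (sym (at-col c d)))

  at-cong : ∀ {c d e} → SameV d e → at c d ≡ at c e
  at-cong {c} {d} {e} v = at-unique (SameV-trans v (at-SameV c e)) (at-col c e)

  -- The edge of `d` separates the faces of `d` and `s d`. It avoids the 1-faces exactly when the
  -- remaining face at the vertex, that of `s (s d)`, is the 1-face.
  HDart-third : ∀ {d} → col (s (s d)) ≡ c1 → HDart col d
  HDart-third {d} eq =
    (λ p → col-σσ≢ d (trans eq (sym p))) ,
    (λ p → col-σ≢ (s d) (trans eq (trans (sym p) (col-ασ d))))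

  HDart⇒third : ∀ {d} → HDart col d → col (s (s d)) ≡ c1
  HDart⇒third {d} (p , q) with has-color c1 d
  ... | inj₁ r        = contradiction (sym r) p
  ... | inj₂ (inj₁ r) = contradiction (trans (col-ασ d) (sym r)) q
  ... | inj₂ (inj₂ r) = sym r

  HDart-α : ∀ {d} → HDart col d → HDart col (a d)
  HDart-α {d} (p , q) = q , (λ r → p (trans (cong col (sym (α-inv d))) r))

  Inc-edge⁺ : ∀ {x F d} → SameF x d → SameF F (a d) → Inc x F
  Inc-edge⁺ {d = d} xd Fd = d , s d , xd , SameF-trans Fd SameF-ασ , SameV-σ

  -- At a cubic vertex any two of the three faces share an edge ending there. This turns radial
  -- incidence into dual adjacency.
  Inc-edge⁻ : ∀ {x F} → col x ≢ col F → Inc x F → ∃[ d ] (SameF x d × SameF F (a d))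
  Inc-edge⁻ x≢F (u , v , xu , Fv , uv) with SameV-cases uv
  ... | inj₁ refl        = contradiction (trans (col-SameF xu) (sym (col-SameF Fv))) x≢F
  ... | inj₂ (inj₁ refl) = u , xu , SameF-trans Fv (SameF-sym SameF-ασ)
  ... | inj₂ (inj₂ refl) = a v , SameF-trans xu (subst (λ z → SameF z (a v)) (σ³ u) (SameF-sym SameF-ασ)) ,
                           subst (SameF _) (sym (α-inv v)) Fv

  CStep⇒Conn : ∀ {S d e} → Star (CStep S) d e → Conn σ S d e
  CStep⇒Conn = Star.map λ { (cσ d) → rot d ; (cα d p) → cross d p }

  Conn⇒CStep : ∀ {S d e} → Conn σ S d e → Star (CStep S) d e
  Conn⇒CStep = Star.map λ { (rot d) → cσ d ; (cross d p) → cα d p }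

  -- The middle term of all equivalences: it mentions neither the outer face nor a contracted
  -- colour, so each statement can be compared with it separately.
  Core : (Fin n → Bool) → Set
  Core S = IsHamCycle S × (∀ d → HDart col d → S d ≡ true)

  edgeIn-single : ∀ e d → d ≢ e → d ≢ a e → edgeIn (e ∷ []) d ≡ false
  edgeIn-single e d d≢e d≢αe with edgeIn (e ∷ []) d in eq
  ... | false = refl
  ... | true with edgeIn⁻ (e ∷ []) d eq
  ... | inj₁ (here p) = contradiction p d≢e
  ... | inj₂ (here p) = contradiction (trans (sym (α-inv d)) (cong a p)) d≢αe

  edgeIn-single⁻ : ∀ e d → edgeIn (e ∷ []) d ≡ false → d ≢ e × d ≢ a e
  edgeIn-single⁻ e d eq =
    (λ p → false≢true eq (edgeIn⁺ (e ∷ []) d (inj₁ (here p)))) ,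
    (λ p → false≢true eq (edgeIn⁺ (e ∷ []) d (inj₂ (here (trans (cong a p) (α-inv e))))))

  offEdge : (Fin n → Bool) → Fin n → Fin n → Bool
  offEdge S e d = not (S d) ∧ not (edgeIn (e ∷ []) d)

  offEdge⁻ : ∀ S e d → offEdge S e d ≡ true → S d ≡ false × d ≢ e × d ≢ a e
  offEdge⁻ S e d eq with ∧-inv eq
  ... | p , q = not-true p , edgeIn-single⁻ e d (not-true q)

  offEdge⁺ : ∀ S e d → S d ≡ false → d ≢ e → d ≢ a e → offEdge S e d ≡ true
  offEdge⁺ S e d p q r = ∧-intro (cong not p) (cong not (edgeIn-single e d q r))

  offEdge-sym : ∀ {S} e → Sym S → Sym (offEdge S e)
  offEdge-sym e symS d = cong₂ _∧_ (not-sym symS d) (not-sym (edgeIn-sym (e ∷ [])) d)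

  -- Two common edges of two faces would form a 2-edge-cut by bridge,
  -- and one end of each, both on the same side, would then be a 2-vertex-cut.
  module _ (threeConn : ThreeConnected) where

    -- The vertex of `d` has two further edges, neither of which is deleted. By simplicity their far
    -- ends are distinct and differ from this vertex, so at least one of them is not the other
    -- removed vertex.
    escape : ∀ (B : Fin n → Bool) d d′ → SameF d d′ → SameF (a d) (a d′) →
      (∀ x → x ≢ d → x ≢ a d → x ≢ d′ → x ≢ a d′ → B x ≡ true) →
      ∃[ z ] (¬ (SameV d z ⊎ SameV (a d′) z) × Conn σ B d z)
    escape B d d′ dd′ αα′ Bok with SameOrbit? σ (a d′) (a (s (s d)))
    ... | no ¬far = a (s (s d)) , [ loop₂ , ¬far ]′ ,
          rot d ◅ rot (s d) ◅ cross (s (s d)) B₂ ◅ ε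
      where
      loop₂ : ¬ SameV d (a (s (s d)))
      loop₂ v = proj₁ simple (s (s d)) (SameV-trans (SameV-sym SameV-σσ) v)
      B₂ : B (s (s d)) ≡ true
      B₂ = Bok _ (λ p → col-σσ≢ d (cong col p))
        (λ p → col-σ≢ (s d) (trans (cong col p) (col-ασ d)))
        (λ p → col-σσ≢ d (trans (cong col p) (sym (col-SameF dd′))))
        (λ p → col-σ≢ (s d) (trans (cong col p) (trans (sym (col-SameF αα′)) (col-ασ d))))
    ... | yes far = a (s d) , [ loop₁ , double ]′ , rot d ◅ cross (s d) B₁ ◅ ε
      where
      loop₁ : ¬ SameV d (a (s d))
      loop₁ v = proj₁ simple (s d) (SameV-trans (SameV-sym SameV-σ) v)
      double : ¬ SameV (a d′) (a (s d))
      double v = proj₁ (cubic (s d)) (sym (proj₂ simple (s d) (s (s d)) SameV-σ (SameV-trans (SameV-sym v) far)))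
      B₁ : B (s d) ≡ true
      B₁ = Bok _ (λ p → col-σ≢ d (cong col p))
        (λ p → proj₁ simple d (1 , p))
        (λ p → col-σ≢ d (trans (cong col p) (sym (col-SameF dd′))))
        (λ p → proj₁ simple (s (s d)) (SameV-trans (SameV-sym SameV-σσ) (SameV-trans (1 , p) far)))

    share-one-edge : ∀ d d′ → SameF d d′ → SameF (a d) (a d′) → d ≡ d′
    share-one-edge d d′ dd′ αα′ with d Fin.≟ d′
    ... | yes p    = p
    ... | no d≢d′ = ⊥-elim (bridge (proj₁ (proj₂ (proj₂ plane))) (proj₂ (proj₂ (proj₂ plane)))
          B B-sym B-conn (edgeIn (d′ ∷ [])) d (B-false d (inj₁ (here refl))) crossing around)
      where
      l = d ∷ d′ ∷ []
      B : Fin n → Bool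
      B x = not (edgeIn l x)
      B-sym : Sym B
      B-sym = not-sym (edgeIn-sym l)
      B-false : ∀ x → x ∈ l ⊎ a x ∈ l → B x ≡ false
      B-false x p = cong not (edgeIn⁺ l x p)
      B-true : ∀ x → x ≢ d → x ≢ a d → x ≢ d′ → x ≢ a d′ → B x ≡ true
      B-true x p q p′ q′ with edgeIn l x in eq
      ... | false = refl
      ... | true with edgeIn⁻ l x eq
      ... | inj₁ (here r)         = contradiction r p
      ... | inj₁ (there (here r)) = contradiction r p′
      ... | inj₂ (here r)         = contradiction (trans (sym (α-inv x)) (cong a r)) q
      ... | inj₂ (there (here r)) = contradiction (trans (sym (α-inv x)) (cong a r)) q′
      d′≢αd : d′ ≢ a d
      d′≢αd p = col-α≢ d (trans (cong col (sym p)) (sym (col-SameF dd′)))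
      crossing : ∀ x → edgeIn (d′ ∷ []) x ≡ true → B x ≡ false × x ≢ d × x ≢ a d
      crossing x eq with edgeIn⁻ (d′ ∷ []) x eq
      ... | inj₁ (here refl) = B-false x (inj₁ (there (here refl))) , d≢d′ ∘ sym , d′≢αd
      ... | inj₂ (here refl) = B-false x (inj₂ (there (here refl))) ,
            (λ p → d′≢αd (cong a p)) , (λ p → d≢d′ (sym (trans (cong a p) (α-inv d))))
      around : Conn φₚ (edgeIn (d′ ∷ [])) d (a d)
      around = orbit⇒Conn dd′ ◅◅ (cross d′ (edgeIn⁺ (d′ ∷ []) d′ (inj₁ (here refl))) ◅ orbit⇒Conn (SameF-sym αα′))
      Removed : Fin n → Set
      Removed z = SameV d z ⊎ SameV (a d′) z
      -- A walk that avoids one end of each deleted edge crosses neither of them.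
      fromAvoid : ∀ {x y} → ¬ Removed x → Star (AvoidStep Removed) x y → Conn σ B x y
      fromAvoid ¬r ε              = ε
      fromAvoid ¬r (aσ x ¬r′ ◅ r) = rot x ◅ fromAvoid ¬r′ r
      fromAvoid ¬r (aα x ¬r′ ◅ r) = cross x (B-true x
        (λ { refl → ¬r (inj₁ SameV-refl) })
        (λ { refl → ¬r′ (inj₁ (0 , sym (α-inv d))) })
        (λ { refl → ¬r′ (inj₂ SameV-refl) })
        (λ { refl → ¬r (inj₂ SameV-refl) })) ◅ fromAvoid ¬r′ r
      free : ∀ x → ∃[ z ] (¬ Removed z × Conn σ B x z)
      free x with SameOrbit? σ d x | SameOrbit? σ (a d′) x
      ... | no p  | no q = x , [ p , q ]′ , ε
      ... | yes p | _ with escape B d d′ dd′ αα′ B-true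
      ...   | z , ¬r , c = z , ¬r , orbit⇒Conn (SameV-sym p) ◅◅ c
      -- Reversing both darts and exchanging them swaps the two removed vertices, so this is the
      -- previous case again.
      free x | no _ | yes q with escape B (a d′) (a d) (SameF-sym αα′)
                 (subst₂ SameF (sym (α-inv d′)) (sym (α-inv d)) (SameF-sym dd′))
                 (λ x p p′ q q′ → B-true x (λ r → q′ (trans r (sym (α-inv d)))) q
                                            (λ r → p′ (trans r (sym (α-inv d′)))) p)
      ...   | z , ¬r , c = z , (λ r → ¬r (swap (⊎.map₁ (subst (λ y → SameV y z) (sym (α-inv d))) r))) ,
              orbit⇒Conn (SameV-sym q) ◅◅ c
      B-conn : ∀ x y → Conn σ B x y
      B-conn x y with free x | free y
      ... | z , ¬r , c | z′ , ¬r′ , c′ =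
        c ◅◅ (fromAvoid ¬r (proj₂ threeConn d (a d′) z z′ ¬r ¬r′) ◅◅ Conn-sym B-sym c′)

  -- The region formed by the k-faces and the faces in T, and its boundary

  -- Going once around a vertex, membership in the region changes an even number of times; it is not
  -- constant on the three faces, so it changes exactly twice.
  two-of-three : ∀ p q r → p ≡ true ⊎ q ≡ true ⊎ r ≡ true → p ≡ false ⊎ q ≡ false ⊎ r ≡ false →
    count3 (p xor q) (q xor r) (r xor p) ≡ 2
  two-of-three true  true  true  _ (inj₁ ())
  two-of-three true  true  true  _ (inj₂ (inj₁ ()))
  two-of-three true  true  true  _ (inj₂ (inj₂ ()))
  two-of-three true  true  false _ _ = refl
  two-of-three true  false true  _ _ = refl
  two-of-three true  false false _ _ = refl
  two-of-three false true  true  _ _ = refl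
  two-of-three false true  false _ _ = refl
  two-of-three false false true  _ _ = refl
  two-of-three false false false (inj₁ ()) _
  two-of-three false false false (inj₂ (inj₁ ())) _
  two-of-three false false false (inj₂ (inj₂ ())) _

  module Region (k : Color) (k≢1 : k ≢ c1) (T : Fin n → Bool)
    (T-φ : ∀ d → T (φ d) ≡ T d) (T-col : ∀ d → T d ≡ true → col d ≡ c1) where

    inside : Fin n → Bool
    inside d = does (col d ≟c k) ∨ T d

    boundary : Fin n → Bool
    boundary d = inside d xor inside (a d)

    inside-φ : ∀ d → inside (φ d) ≡ inside d
    inside-φ d = cong₂ (λ c t → does (c ≟c k) ∨ t) (proj₁ proper d) (T-φ d)

    inside-SameF : ∀ {d e} → SameF d e → inside d ≡ inside e
    inside-SameF (zero  , refl) = refl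
    inside-SameF (suc j , refl) = trans (inside-SameF (j , refl)) (sym (inside-φ _))

    inside-k : ∀ {d} → col d ≡ k → inside d ≡ true
    inside-k {d} p = cong (_∨ T d) (dec-true (col d ≟c k) p)

    inside-T : ∀ {d} → T d ≡ true → inside d ≡ true
    inside-T {d} p = trans (cong (does (col d ≟c k) ∨_) p) (Bool.∨-zeroʳ _)

    inside-other : ∀ {d} → col d ≢ k → col d ≢ c1 → inside d ≡ false
    inside-other {d} p q with T d in eq
    ... | false = trans (Bool.∨-identityʳ _) (dec-false (col d ≟c k) p)
    ... | true  = contradiction (T-col d eq) q

    inside⁻ : ∀ {d} → inside d ≡ true → col d ≡ k ⊎ T d ≡ true
    inside⁻ {d} eq = ⊎.map₁ (does-true (col d ≟c k)) (∨-inv eq)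

    T≢k : ∀ {d} → T d ≡ true → col d ≢ k
    T≢k p q = k≢1 (trans (sym q) (T-col _ p))

    boundary-sym : Sym boundary
    boundary-sym d = trans (cong (λ z → inside (a d) xor inside z) (α-inv d)) (Bool.xor-comm (inside (a d)) (inside d))

    boundary-false : ∀ {d} → inside d ≡ true → inside (a d) ≡ true → boundary d ≡ false
    boundary-false p q rewrite p | q = refl

    boundary-HDart : ∀ d → HDart col d → boundary d ≡ true
    boundary-HDart d (p , q) with color-cover c1 (col d) (col (a d)) (p ∘ sym) (col-α≢ d ∘ sym) (q ∘ sym) k
    ... | inj₁ r        = contradiction r k≢1
    ... | inj₂ (inj₁ r) rewrite inside-k {d} (sym r) | inside-other {a d} (λ t → col-α≢ d (trans t r)) q = refl
    ... | inj₂ (inj₂ r) rewrite inside-k {a d} (sym r) | inside-other {d} (λ t → col-α≢ d (trans (sym r) (sym t))) p = refl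

    boundary-2-regular : ∀ d → count3 (boundary d) (boundary (s d)) (boundary (s (s d))) ≡ 2
    boundary-2-regular d
      rewrite inside-SameF (SameF-ασ {d}) | inside-SameF (SameF-ασ {s d}) | inside-SameF (SameF-ασ {s (s d)}) | σ³ d
      = two-of-three (inside d) (inside (s d)) (inside (s (s d)))
          -- Every vertex meets a k-face, which is inside, and a face of colour `other k`, which is
          -- not.
          (transport k (λ p → inside-k (sym p)))
          (transport (other k) (λ p → inside-other
            (λ t → proj₁ (other-props k k≢1) (trans p t)) (λ t → proj₂ (other-props k k≢1) (trans p t))))
      where
      transport : ∀ c {b} → (∀ {e} → c ≡ col e → inside e ≡ b) →
        inside d ≡ b ⊎ inside (s d) ≡ b ⊎ inside (s (s d)) ≡ b
      transport c f with has-color c d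
      ... | inj₁ p        = inj₁ (f p)
      ... | inj₂ (inj₁ p) = inj₂ (inj₁ (f p))
      ... | inj₂ (inj₂ p) = inj₂ (inj₂ (f p))

    -- Simple paths of faces across U, listed from the far end back to the face of e.
    module _ (e : Fin n) (U : Fin n → Bool) where

      Adj : Fin n → Fin n → Set
      Adj q q′ = ∃[ x ] (SameF q′ x × SameF q (a x) × U x ≡ true)

      data Path : Fin n → List (Fin n) → Set where
        start  : ∀ {q} → SameF e q → Path q []
        extend : ∀ {q q′ Q} → Adj q q′ → All (λ p → ¬ SameF q p) (q′ ∷ Q) → Path q′ Q → Path q (q′ ∷ Q)

      Path-resp : ∀ {q r Q} → SameF q r → Path q Q → Path r Q
      Path-resp qr (start eq) = start (SameF-trans eq qr)
      Path-resp qr (extend (x , p , p′ , u) new π) =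
        extend (x , p , SameF-trans (SameF-sym qr) p′ , u) (All.map (λ ¬s s′ → ¬s (SameF-trans qr s′)) new) π

      Path-truncate : ∀ {q Q p} → Path q Q → p ∈ q ∷ Q → ∃[ Q′ ] Path p Q′
      Path-truncate π              (here refl) = _ , π
      Path-truncate (extend _ _ π) (there p∈)  = Path-truncate π p∈

      -- Loop erasure: when the walk returns to a face already listed, the path is cut back to that
      -- face.
      Path-prolong : ∀ {q r Q} → Path q Q → Conn φₚ U q r → ∃[ Q′ ] Path r Q′
      Path-prolong π ε               = _ , π
      Path-prolong π (rot d ◅ c)     = Path-prolong (Path-resp SameF-φ π) c
      Path-prolong {Q = Q} π (cross d Ud ◅ c) with any? (λ p → SameOrbit? φₚ (a d) p) (d ∷ Q)
      ... | no ¬any = Path-prolong (extend (d , (0 , refl) , (0 , refl) , Ud) (All.¬Any⇒All¬ _ ¬any) π) c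
      ... | yes any with find any
      ... | p , p∈ , αd-p = Path-prolong (Path-resp (SameF-sym αd-p) (proj₂ (Path-truncate π p∈))) c

    module _ (share-one : ∀ d d′ → SameF d d′ → SameF (a d) (a d′) → d ≡ d′)
      (e : Fin n) (Te : T e ≡ true) (αe-k : col (a e) ≡ k) where

      private
        U : Fin n → Bool
        U = offEdge boundary e

      Adj-inside : ∀ {q q′} → Adj e U q q′ → inside q ≡ inside q′
      Adj-inside (x , p , p′ , u) = trans (inside-SameF p′)
        (trans (sym (xor≡false (proj₁ (offEdge⁻ boundary e x u)))) (sym (inside-SameF p)))

      Adj-col≢ : ∀ {q q′} → Adj e U q q′ → col q ≢ col q′
      Adj-col≢ (x , p , p′ , _) eq = col-α≢ x (trans (sym (col-SameF p′)) (trans eq (col-SameF p)))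

      Path-inside : ∀ {q Q} → Path e U q Q → inside q ≡ true
      Path-inside (start eq)       = trans (sym (inside-SameF eq)) (inside-T Te)
      Path-inside (extend adj _ π) = trans (Adj-inside adj) (Path-inside π)

      Adj-Inc : ∀ {q q′} → Adj e U q q′ → Inc q q′ × Inc q′ q
      Adj-Inc {q} {q′} (x , p , p′ , _) = Inc-edge⁺ p′ (subst (SameF q′) (sym (α-inv x)) p) , Inc-edge⁺ p p′

      RadialPair : Fin n × Fin n → Set
      RadialPair (x , F) = col x ≡ k × T F ≡ true × Inc x F

      Follows : Fin n × Fin n → Fin n × Fin n → Set
      Follows (x , F) (x′ , F′) = Inc x′ F

      -- A simple dual path from `x` back to the face of `e`, grouped into the pairs that `RCycle`
      -- expects; the faces on it alternate between k-faces and faces of `T`. `chain` leaves the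
      -- closing pair open, `long` isolates the path with a single crossing, and `fresh` carries
      -- distinctness over from the faces of the path.
      record Zigzag (x : Fin n) (Q : List (Fin n)) : Set where
        field
          F      : Fin n
          P      : List (Fin n × Fin n)
          pairs  : All RadialPair ((x , F) ∷ P)
          chain  : ∀ z → Inc (proj₁ z) e → Chain Follows (x , F) (P ++ [ z ])
          verts≢ : AllPairs (λ p p′ → ¬ SameF (proj₁ p) (proj₁ p′)) ((x , F) ∷ P)
          faces≢ : AllPairs (λ p p′ → ¬ SameF (proj₂ p) (proj₂ p′)) ((x , F) ∷ P)
          long   : 1 ≤ length P ⊎ (Adj e U x F × SameF e F)
          fresh  : ∀ {u} → All (λ p → ¬ SameF u p) (x ∷ Q) →
                   All (λ p → ¬ SameF u (proj₁ p) × ¬ SameF u (proj₂ p)) ((x , F) ∷ P)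

      face-T : ∀ {q q′ Q} → col q ≡ k → Adj e U q q′ → Path e U q′ Q → T q′ ≡ true
      face-T ck adj π with inside⁻ (Path-inside π)
      ... | inj₁ ck′ = contradiction (trans ck (sym ck′)) (Adj-col≢ adj)
      ... | inj₂ t   = t

      vertex-k : ∀ {q q′ Q} → T q ≡ true → Adj e U q q′ → Path e U q′ Q → col q′ ≡ k
      vertex-k t adj π with inside⁻ (Path-inside π)
      ... | inj₁ ck = ck
      ... | inj₂ t′ = contradiction (trans (T-col _ t) (sym (T-col _ t′))) (Adj-col≢ adj)

      zigzag : ∀ {x Q} → col x ≡ k → Path e U x Q → Zigzag x Q
      zigzag ck (start eq) = contradiction (trans (col-SameF eq) ck) (T≢k Te)
      zigzag {x} ck (extend {q′ = F} adj new π@(start eq)) = record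
        { F = F ; P = []
        ; pairs = (ck , face-T ck adj π , proj₁ (Adj-Inc adj)) ∷ []
        ; chain = λ { z (u , v , p , q , r) → (u , v , p , SameF-trans (SameF-sym eq) q , r) , _ }
        ; verts≢ = [] ∷ [] ; faces≢ = [] ∷ []
        ; long = inj₂ (adj , eq)
        ; fresh = λ { (p ∷ q ∷ []) → (p , q) ∷ [] } }
      zigzag {x} ck (extend {q′ = F} adj (_ ∷ new) π@(extend {q′ = x′} adj′ new′ π′)) = record
        { F = F ; P = (x′ , Z.F) ∷ Z.P
        ; pairs = (ck , TF , proj₁ (Adj-Inc adj)) ∷ Z.pairs
        ; chain = λ z inc → proj₂ (Adj-Inc adj′) , Z.chain z inc
        ; verts≢ = All.map proj₁ (Z.fresh new) ∷ Z.verts≢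
        ; faces≢ = All.map proj₂ (Z.fresh new′) ∷ Z.faces≢
        ; long = inj₁ (s≤s z≤n)
        ; fresh = λ { (p ∷ q ∷ ps) → (p , q) ∷ Z.fresh ps } }
        where
        TF = face-T ck adj π
        module Z = Zigzag (zigzag (vertex-k TF adj′ π′) π′)

      dual-walk⇒cycle : Conn φₚ U e (a e) → RCycle col k T
      dual-walk⇒cycle c with Path-prolong e U (start (0 , refl)) c
      ... | Q , π = (a e , F) ∷ P , len , pairs , chain (a e , F) (Inc-edge⁺ (0 , refl) (0 , sym (α-inv e))) , verts≢ , faces≢
        where
        open Zigzag (zigzag αe-k π)
        len : 2 ≤ suc (length P)
        len with long
        ... | inj₁ l = s≤s l
        -- A path with a single crossing would give the faces of `e` and `a e` a second common edge.
        ... | inj₂ ((x , p , p′ , u) , eF) = contradiction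
          (sym (share-one e x (SameF-trans eF p) p′)) (proj₁ (proj₂ (offEdge⁻ boundary e x u)))

      tree-edge-joined : ¬ RCycle col k T → Conn σ boundary e (a e)
      tree-edge-joined acyclic with dichotomy boundary U boundary-sym (offEdge-sym {boundary} e boundary-sym) e cover
        where
        cover : ∀ d → d ≢ e → d ≢ a e → boundary d ≡ true ⊎ U d ≡ true
        cover d p q with boundary d in eq
        ... | true  = inj₁ refl
        ... | false = inj₂ (cong not (edgeIn-single e d p q))
      ... | inj₁ c = c
      ... | inj₂ c = contradiction (dual-walk⇒cycle c) acyclic

    -- The ends of each edge of an inside face are joined along the boundary, hence so are all
    -- vertices of that face. Radial connectivity carries this from face to face, and every vertex
    -- lies on a k-face.
    tree⇒Core : (∀ d d′ → SameF d d′ → SameF (a d) (a d′) → d ≡ d′) → IsRadialTree col k T → Core boundary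
    tree⇒Core share-one (connected , acyclic) =
      (boundary-sym , boundary-2-regular , (λ d e → Conn⇒CStep (joined d e))) , boundary-HDart
      where
      C : Fin n → Fin n → Set
      C = Conn σ boundary
      C-sym : ∀ {d e} → C d e → C e d
      C-sym = Conn-sym boundary-sym
      C-flip : ∀ {d} → C (a d) (a (a d)) → C d (a d)
      C-flip {d} c = C-sym (subst (C (a d)) (α-inv d) c)
      inner-edge : ∀ d → inside d ≡ true → C d (a d)
      inner-edge d p with boundary d in eq
      ... | true  = cross d eq ◅ ε
      ... | false with inside⁻ p | inside⁻ (trans (sym (xor≡false eq)) p)
      ... | inj₁ ck | inj₁ ck′ = contradiction (trans ck′ (sym ck)) (col-α≢ d)
      ... | inj₂ t  | inj₂ t′  = contradiction (trans (T-col _ t′) (sym (T-col _ t))) (col-α≢ d)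
      ... | inj₂ t  | inj₁ ck  = tree-edge-joined share-one d t ck acyclic
      ... | inj₁ ck | inj₂ t   = C-flip (tree-edge-joined share-one (a d) t (trans (cong col (α-inv d)) ck) acyclic)
      inner-face : ∀ j {d e} → inside d ≡ true → iter φ j d ≡ e → C d e
      inner-face zero    p refl = ε
      inner-face (suc j) {d} p refl = inner-face j p refl ◅◅
        (inner-edge _ (trans (sym (inside-SameF (j , refl))) p) ◅◅ (rot _ ◅ ε))
      along-Inc : ∀ {x F} → inside x ≡ true → inside F ≡ true → Inc x F → C x F
      along-Inc p q (u , v , (i , xu) , (j , Fv) , uv) =
        inner-face i p xu ◅◅ (orbit⇒Conn uv ◅◅ C-sym (inner-face j q Fv))
      along : ∀ {u w} → inside u ≡ true → Star (REdge col k T) u w → C u w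
      along p ε = ε
      along p (vf ck t inc ◅ r) = along-Inc p (inside-T t) inc ◅◅ along (inside-T t) r
      along p (fv t ck inc ◅ r) = C-sym (along-Inc (inside-k ck) p inc) ◅◅ along (inside-k ck) r
      along p (same (j , eq) ◅ r) = inner-face j p eq ◅◅ along (trans (sym (inside-SameF (j , eq))) p) r
      joined : ∀ d e → C d e
      joined d e = orbit⇒Conn (at-SameV k d) ◅◅
        (along (inside-k (at-col k d)) (connected _ _ (inj₁ (at-col k d)) (inj₁ (at-col k e))) ◅◅
         orbit⇒Conn (SameV-sym (at-SameV k e)))

  -- From the cycle to a spanning tree of 1-faces

  complement-of-two : ∀ x y → count3 x y true ≡ 2 → x ≡ not y
  complement-of-two true  false _ = refl
  complement-of-two false true  _ = refl

  not-xor-not : ∀ x y → not x xor not y ≡ x xor y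
  not-xor-not true  true  = refl
  not-xor-not true  false = refl
  not-xor-not false true  = refl
  not-xor-not false false = refl

  module FromCore (S : Fin n → Bool) (core : Core S) (k : Color) (k≢1 : k ≢ c1) where

    S-sym : Sym S
    S-sym = proj₁ (proj₁ core)

    S-conn : ∀ d e → Conn σ S d e
    S-conn d e = CStep⇒Conn (proj₂ (proj₂ (proj₁ core)) d e)

    -- The 1-faces on the same side of S as the k-faces.
    T : Fin n → Bool
    T d = does (col d ≟c c1) ∧ (S d xor does (col (a d) ≟c k))

    T-col : ∀ d → T d ≡ true → col d ≡ c1
    T-col d p = does-true (col d ≟c c1) (proj₁ (∧-inv p))

    T-false : ∀ {d} → col d ≢ c1 → T d ≡ false
    T-false {d} p = cong (_∧ (S d xor does (col (a d) ≟c k))) (dec-false (col d ≟c c1) p)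

    T-true : ∀ {d} → col d ≡ c1 → T d ≡ S d xor does (col (a d) ≟c k)
    T-true {d} p = cong (_∧ (S d xor does (col (a d) ≟c k))) (dec-true (col d ≟c c1) p)

    S-alternates : ∀ w → col (s w) ≡ c1 → S w ≡ not (S (s w))
    S-alternates w p = complement-of-two (S w) (S (s w))
      (subst (λ b → count3 (S w) (S (s w)) b ≡ 2)
        (proj₂ core (s (s w)) (HDart-third (trans (cong (col ∘ s) (σ³ w)) p)))
        (proj₁ (proj₂ (proj₁ core)) w))

    k-alternates : ∀ w → col (s w) ≡ c1 → does (col w ≟c k) ≡ not (does (col (s (s w)) ≟c k))
    k-alternates w p with has-color k w
    ... | inj₁ q = trans (dec-true (col w ≟c k) (sym q))
                     (cong not (sym (dec-false (col (s (s w)) ≟c k) (λ r → col-σσ≢ w (trans r q)))))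
    ... | inj₂ (inj₁ q) = contradiction (trans q p) k≢1
    ... | inj₂ (inj₂ q) = trans (dec-false (col w ≟c k) (λ r → col-σσ≢ w (sym (trans r q))))
                            (cong not (sym (dec-true (col (s (s w)) ≟c k) (sym q))))

    -- Around a 1-face the neighbouring faces alternate between colour k and the other colour. The
    -- edges alternate between lying on the cycle and not, as at each vertex the third edge lies on
    -- it. The xor of the two is therefore constant.
    T-φ : ∀ d → T (φ d) ≡ T d
    T-φ d = go (col d ≟c c1)
      where
      w = a d
      flip : col (s w) ≡ c1 → S d xor does (col w ≟c k) ≡ S (s w) xor does (col (a (s w)) ≟c k)
      flip φd-1 = trans (cong₂ _xor_ (trans (sym (S-sym d)) (S-alternates w φd-1)) (k-alternates w φd-1))
        (trans (not-xor-not (S (s w)) _) (cong (λ c → S (s w) xor does (c ≟c k)) (sym (col-ασ (s w)))))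
      go : Dec (col d ≡ c1) → T (φ d) ≡ T d
      go (no p)  = trans (T-false (λ q → p (trans (sym (proj₁ proper d)) q))) (sym (T-false p))
      go (yes p) = trans (T-true φd-1) (trans (sym (flip φd-1)) (sym (T-true p)))
        where
        φd-1 : col (s w) ≡ c1
        φd-1 = trans (proj₁ proper d) p

    open Region k k≢1 T T-φ T-col public

    inside-1 : ∀ {d} → col d ≡ c1 → inside d ≡ S d xor does (col (a d) ≟c k)
    inside-1 {d} p = trans (cong (_∨ T d) (dec-false (col d ≟c k) (λ q → k≢1 (trans (sym q) p)))) (T-true p)

    inside-≢1 : ∀ {d} → col d ≢ c1 → inside d ≡ does (col d ≟c k)
    inside-≢1 {d} p = trans (cong (does (col d ≟c k) ∨_) (T-false p)) (Bool.∨-identityʳ _)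

    S≡boundary : ∀ d → S d ≡ boundary d
    S≡boundary d = go (col d ≟c c1) (col (a d) ≟c c1)
      where
      go : Dec (col d ≡ c1) → Dec (col (a d) ≡ c1) → S d ≡ boundary d
      go (yes p) _       = sym (trans (cong₂ _xor_ (inside-1 p) (inside-≢1 (λ q → col-α≢ d (trans q (sym p)))))
                                      (xor-cancelʳ (S d) _))
      go (no p)  (yes q) = sym (trans (Bool.xor-comm (inside d) (inside (a d)))
        (trans (cong₂ _xor_ (trans (inside-1 q) (cong₂ _xor_ (S-sym d) (cong (λ z → does (col z ≟c k)) (α-inv d))))
                            (inside-≢1 p))
               (xor-cancelʳ (S d) _)))
      go (no p)  (no q)  = trans (proj₂ core d (p , q)) (sym (boundary-HDart d (p , q)))

    S-false : ∀ {d} → inside d ≡ true → inside (a d) ≡ true → S d ≡ false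
    S-false p q = trans (S≡boundary _) (boundary-false p q)

    -- A walk along the cycle is shadowed by the k-face at its current vertex: a cycle edge lies on
    -- a k-face, which then serves both ends, or on a face of `T`, which meets the k-faces at both
    -- ends.
    radial : ∀ {d e} → Conn σ S d e → Star (REdge col k T) (at k d) (at k e)
    radial = Conn-fold {R = λ d e → Star (REdge col k T) (at k d) (at k e)} ε _◅◅_
      (λ d → subst (Star (REdge col k T) (at k d)) (at-cong SameV-σ) ε) edge
      where
      edge : ∀ d → S d ≡ true → Star (REdge col k T) (at k d) (at k (a d))
      edge d Sd with col d ≟c k | col (a d) ≟c k
      ... | yes p | _ = subst₂ (Star (REdge col k T)) (sym (at-unique SameV-refl p))
                          (sym (at-unique SameV-σ (trans (proj₁ proper d) p))) (same SameF-φ ◅ ε)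
      ... | no _ | yes p = subst₂ (Star (REdge col k T)) (sym (at-unique SameV-σ (trans (sym (col-ασ d)) p)))
                          (sym (at-unique SameV-refl p)) (same (SameF-sym SameF-ασ) ◅ ε)
      ... | no p | no q with xor≡true (trans (sym (S≡boundary d)) Sd)
      ... | inj₁ i = [ (λ r → contradiction r p) , via ]′ (inside⁻ i)
        where
        via : T d ≡ true → Star (REdge col k T) (at k d) (at k (a d))
        via t = vf (at-col k d) t (at k d , d , (0 , refl) , (0 , refl) , SameV-sym (at-SameV k d)) ◅
                fv t (at-col k (a d)) (at k (a d) , φ d , (0 , refl) , SameF-φ ,
                  SameV-trans (SameV-sym (at-SameV k (a d))) SameV-σ) ◅ ε
      ... | inj₂ i = [ (λ r → contradiction r q) , via ]′ (inside⁻ i)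
        where
        via : T (a d) ≡ true → Star (REdge col k T) (at k d) (at k (a d))
        via t = vf (at-col k d) t (at k d , s d , (0 , refl) , SameF-ασ ,
                  SameV-trans (SameV-sym (at-SameV k d)) SameV-σ) ◅
                fv t (at-col k (a d)) (at k (a d) , a d , (0 , refl) , (0 , refl) , SameV-sym (at-SameV k (a d))) ◅ ε

    radial-connected : ∀ u w → RNode col k T u → RNode col k T w → Star (REdge col k T) u w
    radial-connected u w nu nw = toVertex nu ◅◅ (radial (S-conn u w) ◅◅ fromVertex nw)
      where
      near : ∀ {v} → Inc (at k v) v
      near {v} = at k v , v , (0 , refl) , (0 , refl) , SameV-sym (at-SameV k v)
      toVertex : ∀ {v} → RNode col k T v → Star (REdge col k T) v (at k v)
      toVertex (inj₁ p) = subst (Star (REdge col k T) _) (sym (at-unique SameV-refl p)) ε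
      toVertex (inj₂ t) = fv t (at-col k _) near ◅ ε
      fromVertex : ∀ {v} → RNode col k T v → Star (REdge col k T) (at k v) v
      fromVertex (inj₁ p) = subst (λ z → Star (REdge col k T) z _) (sym (at-unique SameV-refl p)) ε
      fromVertex (inj₂ t) = vf (at-col k _) t near ◅ ε

    Inc-inner-edge : ∀ {x F} → col x ≡ k → T F ≡ true → Inc x F →
      ∃[ d ] (SameF x d × SameF F (a d) × S d ≡ false)
    Inc-inner-edge ck t inc with Inc-edge⁻ (λ eq → T≢k t (trans (sym eq) ck)) inc
    ... | d , xd , Fd = d , xd , Fd ,
      S-false (trans (sym (inside-SameF xd)) (inside-k ck)) (trans (sym (inside-SameF Fd)) (inside-T t))

    -- The rest of a cycle is a dual detour around an edge shared by its first vertex and first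
    -- face. Distinctness of vertices and faces keeps the detour off that edge, against `bridge`.
    radial-acyclic : ¬ RCycle col k T
    radial-acyclic ([] , () , _)
    radial-acyclic (_ ∷ [] , s≤s () , _)
    radial-acyclic ((x₀ , F₀) ∷ (x₁ , F₁) ∷ P , _ , (ck₀ , t₀ , inc₀) ∷ (ck₁ , t₁ , inc₁) ∷ oks ,
                    (inc₁₀ , chain) , (x≢₁ ∷ x≢) ∷ _ , (F≢₁ ∷ F≢) ∷ _)
      with Inc-inner-edge ck₀ t₀ inc₀
    ... | y , x₀y , F₀y , Sy =
      bridge (proj₁ (proj₂ (proj₂ plane))) (proj₂ (proj₂ (proj₂ plane))) S S-sym S-conn U y Sy (offEdge⁻ S y)
        (Conn-sym U-sym (orbit⇒Conn (SameF-sym F₀y) ◅◅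
          (back ck₁ t₀ (inj₁ x≢₁) inc₁₀ ◅◅ (link ck₁ t₁ (inj₁ x≢₁) inc₁ ◅◅
          (walk P t₁ F≢₁ chain oks x≢ F≢ ◅◅ orbit⇒Conn x₀y)))))
      where
      U : Fin n → Bool
      U = offEdge S y
      U-sym : Sym U
      U-sym = offEdge-sym {S} y S-sym
      link : ∀ {x F} → col x ≡ k → T F ≡ true → ¬ SameF x₀ x ⊎ ¬ SameF F₀ F → Inc x F → Conn φₚ U x F
      link ck t differs inc with Inc-inner-edge ck t inc
      ... | d , xd , Fd , Sd = orbit⇒Conn xd ◅◅ (cross d (offEdge⁺ S y d Sd d≢y d≢αy) ◅ orbit⇒Conn (SameF-sym Fd))
        where
        d≢y : d ≢ y
        d≢y refl = [ (λ f → f (SameF-trans x₀y (SameF-sym xd))) , (λ f → f (SameF-trans F₀y (SameF-sym Fd))) ]′ differs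
        d≢αy : d ≢ a y
        d≢αy refl = T≢k t₀ (trans (col-SameF F₀y) (trans (sym (col-SameF xd)) ck))
      back : ∀ {x F} → col x ≡ k → T F ≡ true → ¬ SameF x₀ x ⊎ ¬ SameF F₀ F → Inc x F → Conn φₚ U F x
      back ck t differs inc = Conn-sym U-sym (link ck t differs inc)
      walk : ∀ {x F} P → T F ≡ true → ¬ SameF F₀ F → Chain (λ p p′ → Inc (proj₁ p′) (proj₂ p)) (x , F) (P ++ [ (x₀ , F₀) ]) →
        All (λ p → col (proj₁ p) ≡ k × T (proj₂ p) ≡ true × Inc (proj₁ p) (proj₂ p)) P →
        All (λ p → ¬ SameF x₀ (proj₁ p)) P → All (λ p → ¬ SameF F₀ (proj₂ p)) P →
        Conn φₚ U F x₀
      walk [] t F≢ (inc , _) [] [] [] = back ck₀ t (inj₂ F≢) inc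
      walk (_ ∷ P) t F≢ (inc , ch) ((ck , t′ , inc′) ∷ oks) (x≢ ∷ xs) (F≢′ ∷ Fs) =
        back ck t (inj₁ x≢) inc ◅◅ (link ck t′ (inj₁ x≢) inc′ ◅◅ walk P t′ F≢′ ch oks xs Fs)

    Core⇒tree : HasSpanningTreeOf1Faces col k
    Core⇒tree = T , T-φ , T-col , radial-connected , radial-acyclic

  -- Statement (i) and the cycle through all edges off the 1-faces

  I⇒Core : ∀ {o} → StatementI col o → ∃[ S ] Core S
  I⇒Core {o} (S , ham , sides) = S , ham , contains
    where
    -- Such an edge separates a 2-face from a 3-face; were it missing from the cycle, the 2-face
    -- could be reached from outside.
    contains : ∀ d → HDart col d → S d ≡ true
    contains d (p , q) with S d in Sd
    ... | true  = refl
    ... | false with col d in cd | col (a d) in cαd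
    ... | c1 | _  = contradiction refl p
    ... | _  | c1 = contradiction refl q
    ... | c2 | c2 = contradiction (trans cαd (sym cd)) (col-α≢ d)
    ... | c3 | c3 = contradiction (trans cαd (sym cd)) (col-α≢ d)
    ... | c3 | c2 = contradiction (proj₂ (sides d) cd ◅◅ (dα d Sd ◅ ε)) (proj₁ (sides (a d)) cαd)
    ... | c2 | c3 = contradiction (proj₂ (sides (a d)) cαd ◅◅ (dα (a d) (trans (proj₁ ham d) Sd) ◅ ε))
                      (λ out → proj₁ (sides d) cd (subst (Outside S o) (α-inv d) out))

  -- With k = 3, membership in the region is invariant under moves that do not cross the cycle,
  -- which keeps the 2-faces from being outside; connectedness of the radial graph supplies the
  -- walks from the outer face to all 3-faces.
  Core⇒I : ∀ {o} → col o ≡ c3 → ∃[ S ] Core S → StatementI col o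
  Core⇒I {o} co (S , core) = S , proj₁ core , λ d → not-outside d , outside d
    where
    open FromCore S core c3 (λ ())
    preserved : ∀ {d e} → Star (DStep S) d e → inside d ≡ inside e
    preserved = Star.fold (λ d e → inside d ≡ inside e) (λ
      { (dφ d) r → trans (sym (inside-φ d)) r
      ; (dα d p) r → trans (xor≡false (trans (sym (S≡boundary d)) p)) r }) refl
    not-outside : ∀ d → col d ≡ c2 → ¬ Outside S o d
    not-outside d cd out = false≢true
      (inside-other (λ p → contradiction (trans (sym cd) p) λ ()) (λ p → contradiction (trans (sym cd) p) λ ()))
      (trans (sym (preserved out)) (inside-k co))
    faces : ∀ {d e} → SameF d e → Star (DStep S) d e
    faces (j , eq) = iter⇒Star dφ j eq
    there-Inc : ∀ {x F} → col x ≡ c3 → T F ≡ true → Inc x F → Star (DStep S) x F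
    there-Inc ck t inc with Inc-inner-edge ck t inc
    ... | d , xd , Fd , Sd = faces xd ◅◅ (dα d Sd ◅ faces (SameF-sym Fd))
    back-Inc : ∀ {x F} → col x ≡ c3 → T F ≡ true → Inc x F → Star (DStep S) F x
    back-Inc ck t inc with Inc-inner-edge ck t inc
    ... | d , xd , Fd , Sd = faces Fd ◅◅ subst (λ z → Star (DStep S) (a d) z) (α-inv d) (dα (a d) (trans (S-sym d) Sd) ◅ ε)
                               ◅◅ faces (SameF-sym xd)
    toDual : ∀ {d e} → Star (REdge col c3 T) d e → Star (DStep S) d e
    toDual ε                 = ε
    toDual (vf ck t inc ◅ r) = there-Inc ck t inc ◅◅ toDual r
    toDual (fv t ck inc ◅ r) = back-Inc ck t inc ◅◅ toDual r
    toDual (same p ◅ r)      = faces p ◅◅ toDual r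
    outside : ∀ d → col d ≡ c3 → Outside S o d
    outside d cd = toDual (radial-connected o d (inj₁ co) (inj₁ cd))

  -- Vertices of G as darts of H

  open DecMembership (Fin._≟_ {n}) using (_∈?_)
  open DecMembership (Product.≡-dec (Fin._≟_ {n}) (Fin._≟_ {n})) using () renaming (_∈?_ to _∈ₚ?_)

  -- Each vertex lies on one 1-face, and `h d` is the dart at the vertex of `d` whose edge avoids
  -- that face. Vertices of G thus correspond to darts of H.
  h : Fin n → Fin n
  h d = s (at c1 d)

  h-HDart : ∀ d → HDart col (h d)
  h-HDart d = HDart-third (trans (cong col (σ³ (at c1 d))) (at-col c1 d))

  h-SameV : ∀ d → SameV d (h d)
  h-SameV d = SameV-trans (at-SameV c1 d) SameV-σ

  HDart-unique : ∀ {d e} → SameV d e → HDart col d → HDart col e → e ≡ d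
  HDart-unique {d} {e} v hd he = perm-injective σ (perm-injective σ
    (SameV-col (SameV-trans (SameV-sym SameV-σσ) (SameV-trans v SameV-σσ)) (trans (HDart⇒third hd) (sym (HDart⇒third he)))))

  h-unique : ∀ {d e} → SameV d e → HDart col e → h d ≡ e
  h-unique {d} v he = HDart-unique (SameV-trans (SameV-sym v) (h-SameV d)) he (h-HDart d)

  h-cong : ∀ {d e} → SameV d e → h d ≡ h e
  h-cong v = cong s (at-cong v)

  HDart? : ∀ d → Dec (HDart col d)
  HDart? d = ¬? (col d ≟c c1) ×-dec ¬? (col (a d) ≟c c1)

  ¬HDart : ∀ {d} → ¬ HDart col d → col d ≡ c1 ⊎ col (a d) ≡ c1
  ¬HDart {d} ¬hd with col d ≟c c1 | col (a d) ≟c c1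
  ... | yes p | _     = inj₁ p
  ... | no _  | yes q = inj₂ q
  ... | no p  | no q  = contradiction (p , q) ¬hd

  h-flip-1 : ∀ {f} → col f ≡ c1 → col (h (a f)) ≢ col (h f)
  h-flip-1 {f} p eq = col-σσ≢ (a f) (trans (cong col (sym hαf)) (trans eq (trans (cong col hf) (sym (col-ασ f)))))
    where
    hf : h f ≡ s f
    hf = cong s (at-unique SameV-refl p)
    hαf : h (a f) ≡ s (s (a f))
    hαf = cong s (at-unique SameV-σ (trans (proj₁ proper f) p))

  -- The colour of the H-dart at a vertex is its class in the bipartition of G.
  h-flip : ∀ f → col (h (a f)) ≢ col (h f)
  h-flip f eq with HDart? f
  ... | yes hf = col-α≢ f (trans (cong col (sym (h-unique SameV-refl (HDart-α hf)))) (trans eq (cong col (h-unique SameV-refl hf))))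
  ... | no ¬hf with ¬HDart ¬hf
  ... | inj₁ p = h-flip-1 p eq
  ... | inj₂ p = h-flip-1 p (trans (cong (col ∘ h) (α-inv f)) (sym eq))

  Transition : Fin n → Fin n → Set
  Transition u v = HRot col u v ⊎ HRot col v u

  -- The next vertex along a 1-face is the other end of one of its edges. Hence, with `Transition⁻`,
  -- the transitions allowed to an A-trail are exactly the edges of the 1-faces.
  Transition⁺ : ∀ {f} → ¬ HDart col f → Transition (h f) (h (a f))
  Transition⁺ {f} ¬hf with ¬HDart ¬hf
  ... | inj₁ p = inj₁ (h-HDart f , h-HDart (a f) , f , SameV-sym (h-SameV f) , p ,
                       SameV-trans (SameV-sym SameV-σ) (h-SameV (a f)))
  ... | inj₂ p = inj₂ (h-HDart (a f) , h-HDart f , a f , SameV-sym (h-SameV (a f)) , p ,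
                       SameV-trans (SameV-sym (1 , sym (φα f))) (h-SameV f))

  Transition⁻ : ∀ {u v} → Transition u v → ∃[ f ] (¬ HDart col f × h f ≡ u × h (a f) ≡ v)
  Transition⁻ (inj₁ (hu , hv , f , u~f , p , φf~v)) =
    f , (λ hf → proj₁ hf p) , h-unique (SameV-sym u~f) hu , h-unique (SameV-trans SameV-σ φf~v) hv
  Transition⁻ (inj₂ (hv , hu , f , v~f , p , φf~u)) =
    a f , (λ hf → proj₂ hf (trans (cong col (α-inv f)) p)) , h-unique (SameV-trans SameV-σ φf~u) hu ,
    trans (cong h (α-inv f)) (h-unique (SameV-sym v~f) hv)

  -- Counting occurrences in a trail

  occ-∉ : ∀ {L d} → ¬ d ∈ L → occ L d ≡ 0
  occ-∉ {L} {d} d∉L = cong length (filter-none (Fin._≟ d) (All.¬Any⇒All¬ L (λ p → d∉L (Any.map sym p))))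

  occ-∈ : ∀ {L d} → d ∈ L → 1 ≤ occ L d
  occ-∈ {L} {d} d∈L with filter (Fin._≟ d) L | ∈-filter⁺ (Fin._≟ d) d∈L refl
  ... | _ ∷ _ | _ = s≤s z≤n

  occ-head : ∀ L d → occ (d ∷ L) d ≡ suc (occ L d)
  occ-head L d = cong length (filter-accept (Fin._≟ d) refl)

  occ-tail : ∀ x L d → occ L d ≤ occ (x ∷ L) d
  occ-tail x L d with x Fin.≟ d
  ... | yes _ = ℕ.n≤1+n _
  ... | no _  = ℕ.≤-refl

  occ-Unique : ∀ {L d} → Unique L → d ∈ L → occ L d ≡ 1
  occ-Unique {x ∷ L} (u ∷ us) (here refl) = trans (occ-head L x) (cong suc (occ-∉ (λ p → All.lookup u p refl)))
  occ-Unique (u ∷ us) (there p)   = trans (cong length (filter-reject (Fin._≟ _) (All.lookup u p))) (occ-Unique us p)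

  occ≤1⇒Unique : ∀ {L} → (∀ {d} → d ∈ L → occ L d ≤ 1) → Unique L
  occ≤1⇒Unique {[]}    _  = []
  occ≤1⇒Unique {x ∷ L} le =
    All.tabulate (λ { p refl → ℕ.<-irrefl refl (ℕ.≤-trans (s≤s (occ-∈ p)) (ℕ.≤-trans (ℕ.≤-reflexive (sym (occ-head L x))) (le (here refl)))) })
    ∷ occ≤1⇒Unique (λ {d} p → ℕ.≤-trans (occ-tail x L d) (le (there p)))

  Chain-applyUpTo : ∀ {R : Fin n → Fin n → Set} (g : ℕ → Fin n) → (∀ i → R (g i) (g (suc i))) → ∀ q →
    Chain R (g 0) (applyUpTo (g ∘ suc) q ++ [ g (suc q) ])
  Chain-applyUpTo g r zero    = r 0 , _
  Chain-applyUpTo g r (suc q) = r 0 , Chain-applyUpTo (g ∘ suc) (r ∘ suc) q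

  Chain-consecutive : ∀ {R : Fin n → Fin n → Set} {x} ys → Chain R x ys → ∀ {u v} → (u , v) ∈ consecutive x ys → R u v
  Chain-consecutive (y ∷ ys) (r , c) (here refl) = r
  Chain-consecutive (y ∷ ys) (r , c) (there p)   = Chain-consecutive ys c p

  -- The A-trail follows the hamiltonian cycle, entering every 1-edge from its 2-coloured dart.
  module TrailFromCore (S : Fin n → Bool) (core : Core S) where

    S-sym : Sym S
    S-sym = proj₁ (proj₁ core)

    partner-exists : ∀ d → HDart col d → ∃[ f ] (SameV d f × ¬ HDart col f × S f ≡ true ×
      (∀ g → SameV d g → S g ≡ true → ¬ HDart col g → g ≡ f))
    partner-exists d hd with S (s d) in S₁ | S (s (s d)) in S₂ | proj₁ (proj₂ (proj₁ core)) d
    ... | true  | true  | two rewrite proj₂ core d hd = contradiction two λ ()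
    ... | false | false | two rewrite proj₂ core d hd = contradiction two λ ()
    ... | true  | false | _ = s d , SameV-σ , (λ h′ → proj₁ (cubic d) (HDart-unique SameV-σ hd h′)) , S₁ , only
      where
      only : ∀ g → SameV d g → S g ≡ true → ¬ HDart col g → g ≡ s d
      only g v Sg ¬hg with SameV-cases v
      ... | inj₁ refl        = contradiction hd ¬hg
      ... | inj₂ (inj₁ p)    = p
      ... | inj₂ (inj₂ refl) = contradiction Sg (false≢true S₂)
    ... | false | true | _ = s (s d) , SameV-σσ , (λ h′ → proj₁ (proj₂ (cubic d)) (HDart-unique SameV-σσ hd h′)) , S₂ , only
      where
      only : ∀ g → SameV d g → S g ≡ true → ¬ HDart col g → g ≡ s (s d)
      only g v Sg ¬hg with SameV-cases v
      ... | inj₁ refl        = contradiction hd ¬hg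
      ... | inj₂ (inj₂ p)    = p
      ... | inj₂ (inj₁ refl) = contradiction Sg (false≢true S₁)

    -- Crosses the 1-face edge that the cycle uses at the vertex of `d`. The default off H is the
    -- identity, so that an involution of all darts results; the decision is an argument so that
    -- proofs can split on it.
    τ′ : ∀ d → Dec (HDart col d) → Fin n
    τ′ d (yes hd) = h (a (proj₁ (partner-exists d hd)))
    τ′ d (no _)   = d

    τ : Fin n → Fin n
    τ d = τ′ d (HDart? d)

    τ-edge : ∀ {f} → S f ≡ true → ¬ HDart col f → τ (h f) ≡ h (a f)
    τ-edge {f} Sf ¬hf = go (HDart? (h f))
      where
      go : ∀ D → τ′ (h f) D ≡ h (a f)
      go (yes hd) = cong (h ∘ a) (sym (proj₂ (proj₂ (proj₂ (proj₂ (partner-exists (h f) hd)))) f (SameV-sym (h-SameV f)) Sf ¬hf))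
      go (no ¬hd) = contradiction (h-HDart f) ¬hd

    partner : ∀ d → HDart col d → ∃[ f ] (¬ HDart col f × S f ≡ true × h f ≡ d)
    partner d hd with partner-exists d hd
    ... | f , v , ¬hf , Sf , _ = f , ¬hf , Sf , h-unique (SameV-sym v) hd

    ¬HDart-α : ∀ {f} → ¬ HDart col f → ¬ HDart col (a f)
    ¬HDart-α {f} ¬hf hαf = ¬hf (subst (HDart col) (α-inv f) (HDart-α hαf))

    τ-other : ∀ {d} → ¬ HDart col d → τ d ≡ d
    τ-other {d} ¬hd = go (HDart? d)
      where
      go : ∀ D → τ′ d D ≡ d
      go (yes hd) = contradiction hd ¬hd
      go (no _)   = refl

    τ-involutive : ∀ d → τ (τ d) ≡ d
    τ-involutive d = go (HDart? d)
      where
      go : Dec (HDart col d) → τ (τ d) ≡ d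
      go (no ¬hd) = trans (cong τ (τ-other ¬hd)) (τ-other ¬hd)
      go (yes hd) with partner d hd
      ... | f , ¬hf , Sf , hf≡d = trans (cong (τ ∘ τ) (sym hf≡d)) (trans (cong τ (τ-edge Sf ¬hf))
        (trans (τ-edge (trans (S-sym f) Sf) (¬HDart-α ¬hf)) (trans (cong h (α-inv f)) hf≡d)))

    -- Advances two edges along the cycle: α crosses the H-edge, then τ crosses the 1-face edge that
    -- follows.
    ψ : Permutation′ n
    ψ = α ∘ₚ permutation τ τ τ-involutive τ-involutive

    -- An edge of H separates a 2-face from a 3-face, so exactly one of its darts qualifies. By
    -- `h-flip` the colours alternate along the cycle, which makes ψ respect this choice.
    Oriented : Fin n → Set
    Oriented d = HDart col d × col d ≡ c2

    not-c1-c2 : ∀ {c} → c ≢ c1 → c ≢ c2 → c ≡ c3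
    not-c1-c2 {c1} p q = contradiction refl p
    not-c1-c2 {c2} p q = contradiction refl q
    not-c1-c2 {c3} p q = refl

    flip-to-c2 : ∀ f → col (h f) ≢ c2 → col (h (a f)) ≡ c2
    flip-to-c2 f p with col (h (a f)) ≟c c2
    ... | yes q = q
    ... | no q  = contradiction (trans (not-c1-c2 (proj₁ (h-HDart (a f))) q) (sym (not-c1-c2 (proj₁ (h-HDart f)) p))) (h-flip f)

    ψ-step : ∀ {d} → Oriented d → Oriented (ψ ⟨$⟩ʳ d) × Transition (a d) (ψ ⟨$⟩ʳ d)
    ψ-step {d} (hd , cd) with partner (a d) (HDart-α hd)
    ... | f , ¬hf , Sf , hf≡ = subst (λ z → Oriented z × Transition (a d) z) (sym ψd)
      ((h-HDart (a f) , flip-to-c2 f (λ p → col-α≢ d (trans (cong col (sym hf≡)) (trans p (sym cd))))) ,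
       subst (λ z → Transition z (h (a f))) hf≡ (Transition⁺ ¬hf))
      where
      ψd : ψ ⟨$⟩ʳ d ≡ h (a f)
      ψd = trans (cong τ (sym hf≡)) (τ-edge Sf ¬hf)

    toC2 : Fin n → Fin n
    toC2 d = if does (col d ≟c c2) then d else a d

    orient : Fin n → Fin n
    orient d = toC2 (h d)

    orient-yes : ∀ {d} → col (h d) ≡ c2 → orient d ≡ h d
    orient-yes {d} p with col (h d) ≟c c2
    ... | yes _ = refl
    ... | no ¬p = contradiction p ¬p

    orient-no : ∀ {d} → col (h d) ≢ c2 → orient d ≡ a (h d)
    orient-no {d} ¬p with col (h d) ≟c c2
    ... | yes p = contradiction p ¬p
    ... | no _  = refl

    orient-Oriented : ∀ d → Oriented (orient d)
    orient-Oriented d with col (h d) ≟c c2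
    ... | yes p = h-HDart d , p
    ... | no ¬p = HDart-α (h-HDart d) ,
      trans (cong col (sym (h-unique SameV-refl (HDart-α (h-HDart d)))))
        (flip-to-c2 (h d) (λ p → ¬p (trans (cong col (sym (h-unique SameV-refl (h-HDart d)))) p)))

    orient-self : ∀ {d} → Oriented d → orient d ≡ d
    orient-self (hd , cd) = trans (orient-yes (trans (cong col (h-unique SameV-refl hd)) cd)) (h-unique SameV-refl hd)

    ψ-edge : ∀ {f} → S f ≡ true → ¬ HDart col f → col (h f) ≢ c2 → SameOrbit ψ (orient f) (orient (a f))
    ψ-edge {f} Sf ¬hf p = 1 ,
      trans (cong (ψ ⟨$⟩ʳ_) (orient-no p)) (trans (cong τ (α-inv (h f)))
        (trans (τ-edge Sf ¬hf) (sym (orient-yes (flip-to-c2 f p)))))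

    -- Shows that a single ψ-orbit traverses all of H: along the cycle an H-edge leaves `orient`
    -- unchanged, and a 1-face edge changes it by ψ or its inverse.
    orient-Conn : ∀ {d e} → Conn σ S d e → SameOrbit ψ (orient d) (orient e)
    orient-Conn = Conn-fold {R = λ d e → SameOrbit ψ (orient d) (orient e)} (SameOrbit-refl ψ) (SameOrbit-trans ψ)
      (λ d → 0 , cong toC2 (h-cong SameV-σ)) edge
      where
      edge : ∀ d → S d ≡ true → SameOrbit ψ (orient d) (orient (a d))
      edge d Sd = go (HDart? d) (col (h d) ≟c c2)
        where
        go : Dec (HDart col d) → Dec (col (h d) ≡ c2) → SameOrbit ψ (orient d) (orient (a d))
        go (yes hd) (yes p) = 0 , trans (orient-yes p) (trans (h-unique SameV-refl hd) (sym
          (trans (orient-no (λ q → h-flip d (trans q (sym p))))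
          (trans (cong a (h-unique SameV-refl (HDart-α hd))) (α-inv d)))))
        go (yes hd) (no p) = 0 , trans (orient-no p) (trans (cong a (h-unique SameV-refl hd)) (sym
          (trans (orient-yes (flip-to-c2 d p)) (h-unique SameV-refl (HDart-α hd)))))
        go (no ¬hd) (no p) = ψ-edge Sd ¬hd p
        go (no ¬hd) (yes p) = SameOrbit-sym ψ (subst (λ z → SameOrbit ψ (orient (a d)) (orient z)) (α-inv d)
          (ψ-edge (trans (S-sym d) Sd) (¬HDart-α ¬hd) (λ q → h-flip d (trans q (sym p)))))

    Core⇒trail : Fin n → HasATrail col
    Core⇒trail o = L , All.map (λ {d} (od : Oriented d) → proj₁ od) all-oriented , once , cyclic
      where
      d₀ : Fin n
      d₀ = orient o
      g : ℕ → Fin n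
      g i = iter (ψ ⟨$⟩ʳ_) i d₀
      q : ℕ
      q = proj₁ (minimal-period ψ d₀)
      closes : g (suc q) ≡ d₀
      closes = proj₁ (proj₂ (minimal-period ψ d₀))
      L : List (Fin n)
      L = applyUpTo g (suc q)
      oriented : ∀ i → Oriented (g i)
      oriented zero    = orient-Oriented o
      oriented (suc i) = proj₁ (ψ-step (oriented i))
      all-oriented : All Oriented L
      all-oriented = All.applyUpTo⁺₂ g (suc q) oriented
      cyclic : Cyclic (λ e e′ → HRot col (a e) e′ ⊎ HRot col e′ (a e)) L
      cyclic = subst (λ z → Chain _ d₀ (applyUpTo (g ∘ suc) q ++ [ z ])) closes
        (Chain-applyUpTo {R = λ e e′ → HRot col (a e) e′ ⊎ HRot col e′ (a e)} g (λ i → proj₂ (ψ-step (oriented i))) q)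
      unique : Unique L
      unique = proj₂ (proj₂ (minimal-period ψ d₀))
      covered : ∀ {d} → Oriented d → d ∈ L
      covered {d} od = let k , eq = orient-Conn (CStep⇒Conn (proj₂ (proj₂ (proj₁ core)) o d)) in
        subst (_∈ L) (trans (iter-% (ψ ⟨$⟩ʳ_) q closes k) (trans eq (orient-self od)))
          (∈-applyUpTo⁺ g (m%n<n k (suc q)))
      ∉L : ∀ {d} → col d ≢ c2 → occ L d ≡ 0
      ∉L p = occ-∉ (λ d∈L → p (proj₂ (All.lookup all-oriented d∈L)))
      once : ∀ d → HDart col d → occ L d + occ L (a d) ≡ 1
      once d hd = go (col d ≟c c2)
        where
        αd-2 : col d ≢ c2 → col (a d) ≡ c2
        αd-2 p = trans (cong col (sym (h-unique SameV-refl (HDart-α hd))))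
          (flip-to-c2 d (λ r → p (trans (cong col (sym (h-unique SameV-refl hd))) r)))
        go : Dec (col d ≡ c2) → occ L d + occ L (a d) ≡ 1
        go (yes p) = cong₂ _+_ (occ-Unique unique (covered (hd , p))) (∉L (λ r → col-α≢ d (trans r (sym p))))
        go (no p)  = cong₂ _+_ (∉L p) (occ-Unique unique (covered (HDart-α hd , αd-2 p)))

  -- From an A-trail back to the cycle

  count3-rotate : ∀ x y z → count3 x y z ≡ count3 y z x
  count3-rotate x y z = trans (ℕ.+-assoc (b x) (b y) (b z)) (ℕ.+-comm (b x) (b y + b z))
    where
    b : Bool → ℕ
    b x = if x then 1 else 0

  module CoreFromTrail (x₀ : Fin n) (L₀ : List (Fin n))
    (allH : All (HDart col) (x₀ ∷ L₀))
    (once : ∀ d → HDart col d → occ (x₀ ∷ L₀) d + occ (x₀ ∷ L₀) (a d) ≡ 1)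
    (cyclic : Cyclic (λ e e′ → HRot col (a e) e′ ⊎ HRot col e′ (a e)) (x₀ ∷ L₀)) where

    L : List (Fin n)
    L = x₀ ∷ L₀

    steps : List (Fin n × Fin n)
    steps = consecutive x₀ (L₀ ++ [ x₀ ])

    step-Transition : ∀ {e e′} → (e , e′) ∈ steps → Transition (a e) e′
    step-Transition = Chain-consecutive {R = λ e e′ → Transition (a e) e′} (L₀ ++ [ x₀ ]) cyclic

    L-unique : Unique L
    L-unique = occ≤1⇒Unique (λ {d} d∈L → ℕ.≤-trans (ℕ.m≤m+n _ (occ L (a d)))
      (ℕ.≤-reflexive (once d (All.lookup allH d∈L))))

    L-covers : ∀ {d} → HDart col d → d ∈ L ⊎ a d ∈ L
    L-covers {d} hd with d ∈? L | a d ∈? L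
    ... | yes p | _     = inj₁ p
    ... | no _  | yes q = inj₂ q
    ... | no p  | no q  = contradiction (trans (sym (once d hd)) (cong₂ _+_ (occ-∉ p) (occ-∉ q))) λ ()

    L-once : ∀ {d} → HDart col d → d ∈ L → ¬ a d ∈ L
    L-once {d} hd p q = ℕ.<-irrefl (sym (once d hd)) (ℕ.+-mono-≤ (occ-∈ p) (occ-∈ q))

    first∈L : ∀ {e e′} → (e , e′) ∈ steps → e ∈ L
    first∈L p = subst (_ ∈_) (consecutive-firsts x₀ L₀ x₀) (∈-map⁺ proj₁ p)

    second∈ : ∀ {e e′} → (e , e′) ∈ steps → e′ ∈ L₀ ++ [ x₀ ]
    second∈ p = subst (_ ∈_) (consecutive-seconds x₀ (L₀ ++ [ x₀ ])) (∈-map⁺ proj₂ p)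

    rotated⊆L : ∀ {d} → d ∈ L₀ ++ [ x₀ ] → d ∈ L
    rotated⊆L p = [ there , (λ { (here q) → here q }) ]′ (∈-++⁻ L₀ p)

    L⊆rotated : ∀ {d} → d ∈ L → d ∈ L₀ ++ [ x₀ ]
    L⊆rotated (here p)  = ∈-++⁺ʳ L₀ (here p)
    L⊆rotated (there p) = ∈-++⁺ˡ p

    leaves : ∀ {d} → d ∈ L → ∃[ e ] (d , e) ∈ steps
    leaves d∈L with ∈-map⁻ proj₁ (subst (_ ∈_) (sym (consecutive-firsts x₀ L₀ x₀)) d∈L)
    ... | (_ , e) , p , refl = e , p

    enters : ∀ {d} → d ∈ L → ∃[ e ] (e , d) ∈ steps
    enters d∈L with ∈-map⁻ proj₂ (subst (_ ∈_) (sym (consecutive-seconds x₀ (L₀ ++ [ x₀ ]))) (L⊆rotated d∈L))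
    ... | (e , _) , p , refl = e , p

    -- u and v are the two H-darts of a transition of the trail, in either order.
    Used : Fin n → Fin n → Set
    Used u v = (a u , v) ∈ steps ⊎ (a v , u) ∈ steps

    Used? : ∀ u v → Dec (Used u v)
    Used? u v = (a u , v) ∈ₚ? steps ⊎-dec (a v , u) ∈ₚ? steps

    Used-Transition : ∀ {u v} → Used u v → Transition u v
    Used-Transition {u} {v} (inj₁ p) = subst (λ z → Transition z v) (α-inv u) (step-Transition p)
    Used-Transition {u} {v} (inj₂ p) = swap (subst (λ z → Transition z u) (α-inv v) (step-Transition p))

    Used-total : ∀ {u} → HDart col u → ∃[ v ] Used u v
    Used-total {u} hu with L-covers hu
    ... | inj₂ p with leaves p
    ...   | v , q = v , inj₁ q
    Used-total {u} hu | inj₁ p with enters p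
    ...   | e , q = a e , inj₂ (subst (λ z → (z , u) ∈ steps) (sym (α-inv e)) q)

    -- The trail contains exactly one of `u` and `a u`, and only once: either it leaves through `u`
    -- or it arrives by `a u`. So only one transition involves `u`.
    Used-functional : ∀ {u v v′} → HDart col u → Used u v → Used u v′ → v ≡ v′
    Used-functional hu (inj₁ p) (inj₁ q) = cong proj₂ (Unique-map⇒injective proj₁
      (subst Unique (sym (consecutive-firsts x₀ L₀ x₀)) L-unique) p q refl)
    Used-functional hu (inj₂ p) (inj₂ q) = perm-injective α (cong proj₁ (Unique-map⇒injective proj₂
      (subst Unique (sym (consecutive-seconds x₀ (L₀ ++ [ x₀ ]))) (Unique-rotate L-unique)) p q refl))
    Used-functional hu (inj₁ p) (inj₂ q) = contradiction (first∈L p) (L-once hu (rotated⊆L (second∈ q)))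
    Used-functional hu (inj₂ p) (inj₁ q) = contradiction (first∈L q) (L-once hu (rotated⊆L (second∈ p)))

    InCycle : Fin n → Set
    InCycle d = HDart col d ⊎ Used (h d) (h (a d))

    InCycle? : ∀ d → Dec (InCycle d)
    InCycle? d = HDart? d ⊎-dec Used? (h d) (h (a d))

    InCycle-α : ∀ {d} → InCycle d → InCycle (a d)
    InCycle-α (inj₁ hd)   = inj₁ (HDart-α hd)
    InCycle-α {d} (inj₂ used) = inj₂ (subst (λ z → Used (h (a d)) (h z)) (sym (α-inv d)) (swap used))

    S : Fin n → Bool
    S d = does (InCycle? d)

    S-sym : Sym S
    S-sym d = does-⇔ (mk⇔ (λ p → subst InCycle (α-inv d) (InCycle-α p)) InCycle-α) (InCycle? (a d)) (InCycle? d)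

    S-true : ∀ {d} → InCycle d → S d ≡ true
    S-true {d} = dec-true (InCycle? d)

    Used-edge : ∀ {u v} → Used u v → ∃[ f ] (¬ HDart col f × SameV u f × SameV (a f) v × S f ≡ true)
    Used-edge used with Transition⁻ (Used-Transition used)
    ... | f , ¬hf , refl , refl = f , ¬hf , SameV-sym (h-SameV f) , h-SameV (a f) , S-true (inj₂ used)

    S-2-regular-H : ∀ {u} → HDart col u → count3 (S u) (S (s u)) (S (s (s u))) ≡ 2
    S-2-regular-H {u} hu with Used-total hu
    ... | v , used with Used-edge used
    ... | f , ¬hf , uf , αfv , Sf = go (SameV-cases uf)
      where
      -- By `Used-functional` a second used 1-face edge at this vertex would have the same far end
      -- as `f`, and a simple graph has no parallel edges.
      only : ∀ {g} → SameV u g → g ≢ u → g ≢ f → S g ≡ false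
      only {g} ug g≢u g≢f = dec-false (InCycle? g) λ
        { (inj₁ hg) → g≢u (HDart-unique ug hu hg)
        ; (inj₂ usedg) → g≢f (proj₂ simple g f (SameV-trans (SameV-sym ug) uf)
            (SameV-trans (subst (SameV (a g)) (Used-functional hu (subst (λ z → Used z (h (a g))) (h-unique (SameV-sym ug) hu) usedg) used)
              (h-SameV (a g))) (SameV-sym αfv))) }
      go : f ≡ u ⊎ f ≡ s u ⊎ f ≡ s (s u) → count3 (S u) (S (s u)) (S (s (s u))) ≡ 2
      go (inj₁ refl)        = contradiction hu ¬hf
      go (inj₂ (inj₁ refl))
        rewrite S-true (inj₁ hu) | Sf | only SameV-σσ (proj₁ (proj₂ (cubic u))) (proj₁ (cubic (s u))) = refl
      go (inj₂ (inj₂ refl))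
        rewrite S-true (inj₁ hu) | Sf | only SameV-σ (proj₁ (cubic u)) (proj₁ (cubic (s u)) ∘ sym) = refl

    S-2-regular : ∀ d → count3 (S d) (S (s d)) (S (s (s d))) ≡ 2
    S-2-regular d = go (SameV-cases (h-SameV d))
      where
      go : h d ≡ d ⊎ h d ≡ s d ⊎ h d ≡ s (s d) → count3 (S d) (S (s d)) (S (s (s d))) ≡ 2
      go (inj₁ p) = S-2-regular-H (subst (HDart col) p (h-HDart d))
      go (inj₂ (inj₁ p)) = trans (count3-rotate (S d) (S (s d)) (S (s (s d))))
        (subst (λ z → count3 (S (s d)) (S (s (s d))) (S z) ≡ 2) (σ³ d) (S-2-regular-H (subst (HDart col) p (h-HDart d))))
      go (inj₂ (inj₂ p)) = trans (sym (count3-rotate (S (s (s d))) (S d) (S (s d))))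
        (subst (λ z → count3 (S (s (s d))) (S z) (S (s z)) ≡ 2) (σ³ d) (S-2-regular-H (subst (HDart col) p (h-HDart d))))

    C : Fin n → Fin n → Set
    C = Conn σ S

    C-α : ∀ {e} → HDart col e → C e (a e)
    C-α {e} he = cross e (S-true (inj₁ he)) ◅ ε

    C-step : ∀ {e e′} → (e , e′) ∈ steps → C e e′
    C-step {e} {e′} p with Used-edge {a e} {e′} (inj₁ (subst (λ z → (z , e′) ∈ steps) (sym (α-inv e)) p))
    ... | f , _ , uf , αfv , Sf = C-α (All.lookup allH (first∈L p)) ◅◅
      (orbit⇒Conn uf ◅◅ (cross f Sf ◅ orbit⇒Conn αfv))

    along : ∀ x ys → (∀ {e e′} → (e , e′) ∈ consecutive x ys → C e e′) → ∀ {y} → y ∈ ys → C x y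
    along x (y ∷ ys) c (here refl) = c (here refl)
    along x (y ∷ ys) c (there p)   = c (here refl) ◅◅ along y ys (c ∘ there) p

    C-from-start : ∀ {d} → d ∈ L → C x₀ d
    C-from-start d∈L = along x₀ (L₀ ++ [ x₀ ]) C-step (L⊆rotated d∈L)

    C-start : ∀ d → C x₀ d
    C-start d with L-covers (h-HDart d)
    ... | inj₁ p = C-from-start p ◅◅ orbit⇒Conn (SameV-sym (h-SameV d))
    ... | inj₂ p = C-from-start p ◅◅ (Conn-sym S-sym (C-α (h-HDart d)) ◅◅ orbit⇒Conn (SameV-sym (h-SameV d)))

    trail-Core : Core S
    trail-Core = (S-sym , S-2-regular , (λ d e → Conn⇒CStep (Conn-sym S-sym (C-start d) ◅◅ C-start e))) ,
      (λ d hd → S-true (inj₁ hd))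

  trail⇒Core : Fin n → HasATrail col → ∃[ S ] Core S
  -- The empty list is no trail, because `h o` is a dart of H whose edge must be traversed.
  trail⇒Core o ([] , _ , once , _)              = contradiction (once (h o) (h-HDart o)) λ ()
  trail⇒Core o (x ∷ L , allH , once , cyclic) = _ , CoreFromTrail.trail-Core x L allH once cyclic

theorem2 : (n : ℕ) (σ α : Permutation′ n) (col : Fin n → Color) (o : Fin n) →
    Map.IsPlaneMap σ α → Map.Simple σ α → Map.Cubic σ α → Map.Bipartite σ α →
    Map.ThreeConnected σ α → Map.ProperFaceColoring σ α col → col o ≡ c3 →
    (Map.StatementI σ α col o ⇔ Map.HasATrail σ α col) ×
    (Map.StatementI σ α col o ⇔ Map.HasSpanningTreeOf1Faces σ α col c2) ×
    (Map.StatementI σ α col o ⇔ Map.HasSpanningTreeOf1Faces σ α col c3)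
theorem2 n σ α col o plane simple cubic _ threeConn proper co =
  mk⇔ (λ i → let S , core = I⇒Core i in TrailFromCore.Core⇒trail S core o)
      (λ t → Core⇒I co (trail⇒Core o t)) ,
  tree c2 (λ ()) , tree c3 (λ ())
  where
  open Map σ α
  open Coloured σ α col plane simple cubic proper
  tree : ∀ k → k ≢ c1 → StatementI col o ⇔ HasSpanningTreeOf1Faces col k
  tree k k≢1 = mk⇔
    (λ i → let S , core = I⇒Core i in FromCore.Core⇒tree S core k k≢1)
    (λ (T , T-φ , T-col , radialTree) →
      Core⇒I co (_ , Region.tree⇒Core k k≢1 T T-φ T-col (share-one-edge threeConn) radialTree))
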